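{- Let $S$ be an arbitrary subset of $[t]^n$. Let $k=\frac t2\,\mu(S)^{5/(4n)}$ and $M=\frac{nk}{20t}$, where $n/5$, $k$ and $M$ are taken to be integers. Then there exist a subset $T\subset S$ of size $k^{n/5}$ and a set $I\subset[n]$ of size $n/5$ such that, defining for $x\in[t]^n$ $$N_x=\{x'\in T\mid \mathrm{Match}(x_I,x'_I)\ge M\},$$ we have (i) $\Pr_{x\sim\mu}[N_x=\emptyset]\le 5^{ -M}$, and (ii) $\mathbb{E}_{x\sim\mu}[\log|N_x|]\ge (n/5-M)\log k-\dfrac{n\log k}{5^M}$, where we take $\log 0=-1$ to make this expectation exist.
   Context: $n$ and $t$ are positive integers and $[t]=\{1,\dots,t\}$; logarithms are to base 2. $\mu$ is the uniform distribution on $[t]^n$, so $\mu(S)=|S|/t^n$. For $x\in[t]^n$ and $I\subseteq[n]$, $x_I$ is the projection of $x$ to the coordinates in $I$. $\mathrm{Match}(x_I,y_I)$ is the number of coordinates $i\in I$ with $x_i=y_i$.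
   Formalization: Part (ii) is asserted only for k ≥ 2: for k = 1 it is false (e.g. t = 2, n = 40, S = [2]^40 gives left side −2^{ -8} and right side 0), and for k = 0 (S empty) log k is undefined. -}

module Defs where

open import Algebra.Bundles using (CommutativeRing)
import Algebra.Properties.Semiring.Exp as Exp
open import Data.Bool.Base using (Bool; true; _∧_)
open import Data.Fin.Base using (Fin)
import Data.Fin.Properties as Fin
open import Data.Fin.Subset using (_∩_) renaming (Subset to IndexSet; ∣_∣ to ∣_∣ᴵ)
open import Data.Integer.Base as ℤ using (+_)
import Data.Integer.Properties as ℤ
open import Data.List.Base as List using (List; []; _∷_; foldr; length; null; filterᵇ; allFin; cartesianProductWith)
open import Data.Nat.Base as ℕ using (ℕ; zero; suc; z≤n; s≤s; ⌊_/2⌋)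
open import Data.Nat.Induction using (<-wellFounded)
open import Data.Nat.Logarithm
import Data.Nat.Properties as ℕ
open import Data.Product.Base using (_×_; _,_; proj₁; proj₂; ∃-syntax)
open import Data.Rational.Base
import Data.Rational.Properties as ℚ
import Data.Rational.Unnormalised.Base as ℚᵘ
import Data.Rational.Unnormalised.Properties as ℚᵘ
open import Data.Sum.Base using (inj₁; inj₂)
open import Data.Vec.Base as Vec using (Vec; []; _∷_; zipWith)
open import Induction.WellFounded using (Acc; acc)
open import Relation.Binary.PropositionalEquality
open import Relation.Nullary.Decidable.Core using (does)

fromℕ : ℕ → ℚ
fromℕ n = + n / 1

open Exp (CommutativeRing.semiring ℚ.+-*-commutativeRing) public
  using () renaming (_^_ to _^ℚ_)

-- r = x ^ (p / q), for x ≥ 0 and q > 0.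
IsPower : (r x : ℚ) (p q : ℕ) → Set
IsPower r x p q = 0ℚ ≤ r × r ^ℚ q ≡ x ^ℚ p

-- Equality of reals is not _≡_ : different Cauchy sequences may have the same limit.
record ℝ : Set where
  constructor mkℝ
  field
    approx : ℕ → ℚ
    cauchy : ∀ ε → 0ℚ < ε → ∃[ N ] (∀ i j → N ℕ.≤ i → N ℕ.≤ j →
             ∣ approx i - approx j ∣ ≤ ε)

open ℝ public

infix  4 _≤ℝ_
infixl 6 _+ℝ_ _-ℝ_
infixr 7 _•_

_≤ℝ_ : ℝ → ℝ → Set
x ≤ℝ y = ∀ ε → 0ℚ < ε → ∃[ N ] (∀ i → N ℕ.≤ i → approx x i ≤ approx y i + ε)

fromℚ : ℚ → ℝ
fromℚ q = mkℝ (λ _ → q) λ ε 0<ε → 0 , λ _ _ _ _ → begin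
  ∣ q - q ∣ ≡⟨ cong ∣_∣ (ℚ.+-inverseʳ q) ⟩
  0ℚ        <⟨ 0<ε ⟩
  ε         ∎
  where open ℚ.≤-Reasoning

_+ℝ_ : ℝ → ℝ → ℝ
approx (x +ℝ y) i = approx x i + approx y i
cauchy (x +ℝ y) ε 0<ε = N₁ ℕ.⊔ N₂ , λ i j N≤i N≤j → begin
  ∣ (a i + b i) - (a j + b j) ∣       ≡⟨ cong ∣_∣ (rearrange (a i) (b i) (a j) (b j)) ⟩
  ∣ (a i - a j) + (b i - b j) ∣       ≤⟨ ℚ.∣p+q∣≤∣p∣+∣q∣ (a i - a j) (b i - b j) ⟩
  ∣ a i - a j ∣ + ∣ b i - b j ∣       ≤⟨ ℚ.+-mono-≤
                                          (h₁ i j (ℕ.m⊔n≤o⇒m≤o N₁ N₂ N≤i) (ℕ.m⊔n≤o⇒m≤o N₁ N₂ N≤j))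
                                          (h₂ i j (ℕ.m⊔n≤o⇒n≤o N₁ N₂ N≤i) (ℕ.m⊔n≤o⇒n≤o N₁ N₂ N≤j)) ⟩
  ½ * ε + ½ * ε                       ≡⟨ ℚ.*-distribʳ-+ ε ½ ½ ⟨
  1ℚ * ε                              ≡⟨ ℚ.*-identityˡ ε ⟩
  ε                                   ∎
  where
  open ℚ.≤-Reasoning
  a = approx x
  b = approx y
  0<½ε : 0ℚ < ½ * ε
  0<½ε = subst (_< ½ * ε) (ℚ.*-zeroʳ ½) (ℚ.*-monoʳ-<-pos ½ 0<ε)
  N₁ = proj₁ (cauchy x (½ * ε) 0<½ε)
  N₂ = proj₁ (cauchy y (½ * ε) 0<½ε)
  h₁ = proj₂ (cauchy x (½ * ε) 0<½ε)
  h₂ = proj₂ (cauchy y (½ * ε) 0<½ε)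
  open import Algebra.Properties.CommutativeSemigroup
    (CommutativeRing.+-commutativeSemigroup ℚ.+-*-commutativeRing) using (interchange)
  rearrange : ∀ p q r s → (p + q) - (r + s) ≡ (p - r) + (q - s)
  rearrange p q r s = trans (cong (_+_ (p + q)) (ℚ.neg-distrib-+ r s)) (interchange p q (- r) (- s))

_•_ : ℚ → ℝ → ℝ
approx (q • x) i = q * approx x i
cauchy (q • x) ε 0<ε = N , λ i j N≤i N≤j → begin
  ∣ q * a i - q * a j ∣     ≡⟨ cong ∣_∣ (cong (_+_ (q * a i)) (ℚ.neg-distribʳ-* q (a j))) ⟩
  ∣ q * a i + q * - a j ∣   ≡⟨ cong ∣_∣ (ℚ.*-distribˡ-+ q (a i) (- a j)) ⟨
  ∣ q * (a i - a j) ∣       ≡⟨ ℚ.∣p*q∣≡∣p∣*∣q∣ q (a i - a j) ⟩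
  ∣ q ∣ * ∣ a i - a j ∣     ≤⟨ ℚ.*-monoˡ-≤-nonNeg ∣ q ∣ {{ℚ.∣-∣-nonNeg q}} (h i j N≤i N≤j) ⟩
  ∣ q ∣ * δ                 ≤⟨ ℚ.*-monoʳ-≤-nonNeg δ {{ℚ.pos⇒nonNeg δ {{positive 0<δ}}}} q≤c ⟩
  c * δ                     ≡⟨ ℚ.*-assoc c (1/ c) ε ⟨
  (c * 1/ c) * ε            ≡⟨ cong (_* ε) (ℚ.*-inverseʳ c) ⟩
  1ℚ * ε                    ≡⟨ ℚ.*-identityˡ ε ⟩
  ε                         ∎
  where
  open ℚ.≤-Reasoning
  a = approx x
  c = ∣ q ∣ + 1ℚ
  instance
    c>0 : Positive c
    c>0 = ℚ.nonNeg+pos⇒pos ∣ q ∣ {{ℚ.∣-∣-nonNeg q}} 1ℚ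
    c≢0 : NonZero c
    c≢0 = ℚ.pos⇒nonZero c
  δ = 1/ c * ε
  0<δ : 0ℚ < δ
  0<δ = subst (_< δ) (ℚ.*-zeroʳ (1/ c)) (ℚ.*-monoʳ-<-pos (1/ c) {{ℚ.1/pos⇒pos c}} 0<ε)
  q≤c : ∣ q ∣ ≤ c
  q≤c = subst (_≤ c) (ℚ.+-identityʳ ∣ q ∣) (ℚ.+-monoʳ-≤ ∣ q ∣ (ℚ.<⇒≤ (ℚ.positive⁻¹ 1ℚ)))
  N = proj₁ (cauchy x δ 0<δ)
  h = proj₂ (cauchy x δ 0<δ)

_-ℝ_ : ℝ → ℝ → ℝ
x -ℝ y = x +ℝ (- 1ℚ) • y

sumℝ : List ℝ → ℝ
sumℝ = foldr _+ℝ_ (fromℚ 0ℚ)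

2^⌊log₂n⌋≤n : ∀ n .{{_ : ℕ.NonZero n}} → 2 ℕ.^ ⌊log₂ n ⌋ ℕ.≤ n
2^⌊log₂n⌋≤n n = go n (<-wellFounded n)
  where
  open ℕ.≤-Reasoning
  go : ∀ n .{{_ : ℕ.NonZero n}} → Acc ℕ._<_ n → 2 ℕ.^ ⌊log₂ n ⌋ ℕ.≤ n
  go 1 _ = ℕ.≤-refl
  go n@(suc (suc n′)) (acc rs) = begin
    2 ℕ.^ ⌊log₂ n ⌋                      ≡⟨ cong (2 ℕ.^_) (ℕ.m+[n∸m]≡n (⌊log₂⌋-mono-≤ {2} {n} (s≤s (s≤s z≤n)))) ⟨
    2 ℕ.* 2 ℕ.^ (⌊log₂ n ⌋ ℕ.∸ 1)        ≡⟨ cong (λ l → 2 ℕ.* 2 ℕ.^ l) (⌊log₂⌊n/2⌋⌋≡⌊log₂n⌋∸1 n) ⟨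
    2 ℕ.* 2 ℕ.^ ⌊log₂ ⌊ n /2⌋ ⌋          ≤⟨ ℕ.*-monoʳ-≤ 2 (go ⌊ n /2⌋ (rs (ℕ.⌊n/2⌋<n (suc n′)))) ⟩
    2 ℕ.* ⌊ n /2⌋                        ≡⟨ cong (⌊ n /2⌋ ℕ.+_) (ℕ.+-identityʳ ⌊ n /2⌋) ⟩
    ⌊ n /2⌋ ℕ.+ ⌊ n /2⌋                  ≤⟨ ℕ.+-monoʳ-≤ ⌊ n /2⌋ (ℕ.⌊n/2⌋≤⌈n/2⌉ n) ⟩
    ⌊ n /2⌋ ℕ.+ ℕ.⌈ n /2⌉                ≡⟨ ℕ.⌊n/2⌋+⌈n/2⌉≡n n ⟩
    n                                    ∎

n<2^[1+⌊log₂n⌋] : ∀ n → n ℕ.< 2 ℕ.^ (1 ℕ.+ ⌊log₂ n ⌋)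
n<2^[1+⌊log₂n⌋] n = ℕ.≰⇒> λ 2^≤n → ℕ.<-irrefl refl
  (subst (ℕ._≤ ⌊log₂ n ⌋) (⌊log₂[2^n]⌋≡n (1 ℕ.+ ⌊log₂ n ⌋)) (⌊log₂⌋-mono-≤ 2^≤n))

-- ⌊log₂ (n ^ j)⌋ / j lies in (log₂ n - 1/j , log₂ n].
log₂-approx : (n : ℕ) → ℕ → ℚ
log₂-approx n i = + ⌊log₂ (n ℕ.^ suc i) ⌋ / suc i

/-≤ : ∀ {a b c d} → a ℕ.* suc d ℕ.≤ c ℕ.* suc b → + a / suc b ≤ + c / suc d
/-≤ {a} {b} {c} {d} h = ℚ.toℚᵘ-cancel-≤ (begin
  toℚᵘ (+ a / suc b)    ≃⟨ ℚ.toℚᵘ-fromℚᵘ (ℚᵘ.mkℚᵘ (+ a) b) ⟩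
  ℚᵘ.mkℚᵘ (+ a) b       ≤⟨ ℚᵘ.*≤* (subst₂ ℤ._≤_ (ℤ.pos-* a (suc d)) (ℤ.pos-* c (suc b)) (ℤ.+≤+ h)) ⟩
  ℚᵘ.mkℚᵘ (+ c) d       ≃⟨ ℚ.toℚᵘ-fromℚᵘ (ℚᵘ.mkℚᵘ (+ c) d) ⟨
  toℚᵘ (+ c / suc d)    ∎)
  where open ℚᵘ.≤-Reasoning

/-+ : ∀ a c b → + a / suc b + + c / suc b ≡ + (a ℕ.+ c) / suc b
/-+ a c b = ℚ.toℚᵘ-injective (begin
  toℚᵘ (+ a / suc b + + c / suc b)
    ≈⟨ ℚ.toℚᵘ-homo-+ (+ a / suc b) (+ c / suc b) ⟩
  toℚᵘ (+ a / suc b) ℚᵘ.+ toℚᵘ (+ c / suc b)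
    ≈⟨ ℚᵘ.+-cong (ℚ.toℚᵘ-fromℚᵘ (ℚᵘ.mkℚᵘ (+ a) b)) (ℚ.toℚᵘ-fromℚᵘ (ℚᵘ.mkℚᵘ (+ c) b)) ⟩
  ℚᵘ.mkℚᵘ (+ a) b ℚᵘ.+ ℚᵘ.mkℚᵘ (+ c) b
    ≈⟨ ℚᵘ.*≡* (trans (cong (ℤ._* + suc b) (sym (ℤ.*-distribʳ-+ (+ suc b) (+ a) (+ c))))
                     (ℤ.*-assoc (+ (a ℕ.+ c)) (+ suc b) (+ suc b))) ⟩
  ℚᵘ.mkℚᵘ (+ (a ℕ.+ c)) b
    ≈⟨ ℚ.toℚᵘ-fromℚᵘ (ℚᵘ.mkℚᵘ (+ (a ℕ.+ c)) b) ⟨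
  toℚᵘ (+ (a ℕ.+ c) / suc b) ∎)
  where open import Relation.Binary.Reasoning.Setoid ℚᵘ.≃-setoid

log₂-approx-≤ : ∀ n .{{_ : ℕ.NonZero n}} i j →
                log₂-approx n i ≤ log₂-approx n j + + 1 / suc j
log₂-approx-≤ n i j = subst (log₂-approx n i ≤_) (sym (/-+ (L j) 1 j))
  (/-≤ {L i} {i} {L j ℕ.+ 1} {j} (begin
    L i ℕ.* suc j                               ≡⟨ ⌊log₂[2^n]⌋≡n (L i ℕ.* suc j) ⟨
    ⌊log₂ (2 ℕ.^ (L i ℕ.* suc j)) ⌋             ≤⟨ ⌊log₂⌋-mono-≤ powers ⟩
    ⌊log₂ (2 ℕ.^ ((L j ℕ.+ 1) ℕ.* suc i)) ⌋     ≡⟨ ⌊log₂[2^n]⌋≡n ((L j ℕ.+ 1) ℕ.* suc i) ⟩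
    (L j ℕ.+ 1) ℕ.* suc i                       ∎))
  where
  open ℕ.≤-Reasoning
  L : ℕ → ℕ
  L i = ⌊log₂ (n ℕ.^ suc i) ⌋
  powers : 2 ℕ.^ (L i ℕ.* suc j) ℕ.≤ 2 ℕ.^ ((L j ℕ.+ 1) ℕ.* suc i)
  powers = begin
    2 ℕ.^ (L i ℕ.* suc j)              ≡⟨ ℕ.^-*-assoc 2 (L i) (suc j) ⟨
    (2 ℕ.^ L i) ℕ.^ suc j              ≤⟨ ℕ.^-monoˡ-≤ (suc j) (2^⌊log₂n⌋≤n (n ℕ.^ suc i) {{ℕ.m^n≢0 n (suc i)}}) ⟩
    (n ℕ.^ suc i) ℕ.^ suc j            ≡⟨ ℕ.^-*-assoc n (suc i) (suc j) ⟩
    n ℕ.^ (suc i ℕ.* suc j)            ≡⟨ cong (n ℕ.^_) (ℕ.*-comm (suc i) (suc j)) ⟩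
    n ℕ.^ (suc j ℕ.* suc i)            ≡⟨ ℕ.^-*-assoc n (suc j) (suc i) ⟨
    (n ℕ.^ suc j) ℕ.^ suc i            ≤⟨ ℕ.^-monoˡ-≤ (suc i) (ℕ.<⇒≤ (n<2^[1+⌊log₂n⌋] (n ℕ.^ suc j))) ⟩
    (2 ℕ.^ (1 ℕ.+ L j)) ℕ.^ suc i      ≡⟨ cong (λ l → (2 ℕ.^ l) ℕ.^ suc i) (ℕ.+-comm 1 (L j)) ⟩
    (2 ℕ.^ (L j ℕ.+ 1)) ℕ.^ suc i      ≡⟨ ℕ.^-*-assoc 2 (L j ℕ.+ 1) (suc i) ⟩
    2 ℕ.^ ((L j ℕ.+ 1) ℕ.* suc i)      ∎

log₂-approx-cauchy : ∀ n .{{_ : ℕ.NonZero n}} ε → 0ℚ < ε →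
  ∃[ N ] (∀ i j → N ℕ.≤ i → N ℕ.≤ j → ∣ log₂-approx n i - log₂-approx n j ∣ ≤ ε)
log₂-approx-cauchy n ε 0<ε = N , bound
  where
  open ℚ.≤-Reasoning
  N = ℚᵘ.ℚᵘ.denominator-1 (toℚᵘ ε)
  1/N≤ε : ∀ ε → 0ℚ < ε → + 1 / suc (ℚᵘ.ℚᵘ.denominator-1 (toℚᵘ ε)) ≤ ε
  1/N≤ε ε@(mkℚ (+ suc p) d _) _ = subst (+ 1 / suc d ≤_) (ℚ.↥p/↧p≡p ε)
    (/-≤ {1} {d} {suc p} {d} (ℕ.*-monoˡ-≤ (suc d) {1} {suc p} (s≤s z≤n)))
  1/N≤ε (mkℚ (+ 0) d _) (*<* (ℤ.+<+ ()))
  1/N≤ε (mkℚ ℤ.-[1+ p ] d _) (*<* ())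
  one-sided : ∀ i j → N ℕ.≤ j → log₂-approx n i - log₂-approx n j ≤ ε
  one-sided i j N≤j = begin
    a - b                    ≤⟨ ℚ.+-monoˡ-≤ (- b) (log₂-approx-≤ n i j) ⟩
    (b + + 1 / suc j) - b    ≡⟨ cong (_- b) (ℚ.+-comm b (+ 1 / suc j)) ⟩
    (+ 1 / suc j + b) - b    ≡⟨ ℚ.+-assoc (+ 1 / suc j) b (- b) ⟩
    + 1 / suc j + (b - b)    ≡⟨ cong (_+_ (+ 1 / suc j)) (ℚ.+-inverseʳ b) ⟩
    + 1 / suc j + 0ℚ         ≡⟨ ℚ.+-identityʳ (+ 1 / suc j) ⟩
    + 1 / suc j              ≤⟨ /-≤ {1} {j} {1} {N} (ℕ.*-monoʳ-≤ 1 (s≤s N≤j)) ⟩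
    + 1 / suc N              ≤⟨ 1/N≤ε ε 0<ε ⟩
    ε                        ∎
    where
    a = log₂-approx n i
    b = log₂-approx n j
  swap : ∀ p q → - (p - q) ≡ q - p
  swap p q = trans (ℚ.neg-distrib-+ p (- q))
    (trans (cong (_+_ (- p)) (⁻¹-involutive q)) (ℚ.+-comm (- p) q))
    where open import Algebra.Properties.Group ℚ.+-0-group using (⁻¹-involutive)
  ∣p∣≤ : ∀ {p q} → p ≤ q → - p ≤ q → ∣ p ∣ ≤ q
  ∣p∣≤ {p} {q} p≤q -p≤q with ℚ.∣p∣≡p∨∣p∣≡-p p
  ... | inj₁ eq = subst (_≤ q) (sym eq) p≤q
  ... | inj₂ eq = subst (_≤ q) (sym eq) -p≤q
  bound : ∀ i j → N ℕ.≤ i → N ℕ.≤ j → ∣ log₂-approx n i - log₂-approx n j ∣ ≤ ε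
  bound i j N≤i N≤j = ∣p∣≤ (one-sided i j N≤j)
    (subst (_≤ ε) (sym (swap (log₂-approx n i) (log₂-approx n j))) (one-sided j i N≤i))

-- With the convention log₂ 0 = -1.
log₂ : ℕ → ℝ
log₂ zero      = fromℚ (- 1ℚ)
log₂ n@(suc _) = mkℝ (log₂-approx n) (log₂-approx-cauchy n)

-- A point of [t]^n, the alphabet [t] being Fin t.
Point : ℕ → ℕ → Set
Point t n = Vec (Fin t) n

points : ∀ t n → List (Point t n)
points t zero    = [] ∷ []
points t (suc n) = cartesianProductWith _∷_ (allFin t) (points t n)

PointSet : ℕ → ℕ → Set
PointSet t n = Point t n → Bool

module _ {t n : ℕ} where

  infix 4 _∈_ _⊆_

  _∈_ : Point t n → PointSet t n → Set
  x ∈ A = A x ≡ true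

  _⊆_ : PointSet t n → PointSet t n → Set
  A ⊆ B = ∀ x → x ∈ A → x ∈ B

  elements : PointSet t n → List (Point t n)
  elements A = filterᵇ A (points t n)

  card : PointSet t n → ℕ
  card A = length (elements A)

  isEmpty : PointSet t n → Bool
  isEmpty A = null (elements A)

  Match : IndexSet n → Point t n → Point t n → ℕ
  Match I x y = ∣ I ∩ zipWith (λ a b → does (a Fin.≟ b)) x y ∣ᴵ

  -- The set of x′ ∈ T with Match(x_I , x′_I) ≥ M.
  N[_,_,_] : PointSet t n → IndexSet n → ℕ → Point t n → PointSet t n
  N[ T , I , M ] x x′ = T x′ ∧ (M ℕ.≤ᵇ Match I x x′)

  module _ .{{_ : ℕ.NonZero t}} where

    μ : PointSet t n → ℚ
    μ A = (+ card A / t ℕ.^ n) {{ℕ.m^n≢0 t n}}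

    𝔼 : (Point t n → ℝ) → ℝ
    𝔼 f = (+ 1 / t ℕ.^ n) {{ℕ.m^n≢0 t n}} • sumℝ (List.map f (points t n))

{-# OPTIONS --safe #-}
module Submission where

-- Call I shattered by S if S contains a k-ary tree over the coordinates of I:
-- at a coordinate of I there are k branches, at any other coordinate one.
-- A Sauer–Shelah count bounds |S| by the sum of t ^ |I| k ^ (n - |I|) over the
-- shattered I, so the size of S forces a shattered I with |I| = n / 5 = d; T is
-- the set of leaves of its tree.  For a random x, walk down the tree, following
-- the branch x_i whenever it exists and a random branch otherwise or once M
-- matches have been made.  The number of matches is binomial with mean
-- d k / t = 4 M, so fewer than M occur with probability at most
-- 4 ^ M (1 - 3 k / 4 t) ^ d ≤ (4 / 20) ^ M = 5 ^ -M.  Every successful leaf is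
-- reached with probability k ^ -(d - M), whence |N_x| ≥ k ^ (d - M) p_x, where
-- p_x is the probability of success given x.  This gives (i), and (ii) follows
-- from log p ≥ -5 (1 - p) d log k, which holds for p = 0 as well under the
-- convention log 0 = -1.

open import Defs
open import Algebra.Bundles using (CommutativeRing)
import Algebra.Properties.CommutativeSemigroup as CommutativeSemigroup
import Algebra.Properties.CommutativeSemiring.Exp as Exp
open import Data.Bool.Base using (Bool; true; false; _∧_; if_then_else_)
open import Data.Bool.Properties using (T-≡)
open import Data.Fin.Base using (Fin; zero; suc)
import Data.Fin.Properties as Fin
open import Data.Fin.Subset using (Subset; ∣_∣; ⊤)
open import Data.Fin.Subset.Properties using (∣⊤∣≡n)
open import Data.Integer.Base as ℤ using (+_)
import Data.Integer.Properties as ℤ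
open import Data.List.Base using (List; []; _∷_; _++_; length; null; map; filterᵇ; allFin; tabulate; cartesianProductWith)
open import Data.List.Properties using (length-tabulate)
open import Data.Nat.Base
open import Data.Nat.DivMod using (m≡m%n+[m/n]*n; m%n<n; m/n*n≤m; m*n/n≡m)
open import Data.Nat.Divisibility using (_∣_; divides)
open import Data.Nat.Logarithm
open import Data.Nat.Properties
open import Data.Nat.Tactic.RingSolver using (solve-∀)
open import Data.Product using (_×_; _,_; proj₁; proj₂; ∃-syntax)
open import Data.Rational.Base using (ℚ; mkℚ; *<*; 0ℚ; 1ℚ; toℚᵘ; Positive; NonNegative; nonNegative) renaming (_+_ to _+ℚ_; _*_ to _*ℚ_; _/_ to _/ℚ_; _-_ to _-ℚ_; -_ to -ℚ_; _≤_ to _≤ℚ_; _<_ to _<ℚ_)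
import Data.Rational.Properties as ℚ
import Data.Rational.Unnormalised.Base as ℚᵘ
import Data.Rational.Unnormalised.Properties as ℚᵘ
open import Data.Unit.Base using (tt)
open import Data.Vec.Base using ([]; _∷_)
open import Function.Base using (_∘_)
open import Function.Bundles using (Equivalence)
open import Level using (0ℓ)
open import Relation.Binary.PropositionalEquality hiding (J; [_])
open import Relation.Nullary.Decidable.Core using (does; yes; no; dec⇒maybe)
open import Relation.Nullary.Negation.Core using (contradiction)
import Tactic.RingSolver as Ring
open import Tactic.RingSolver.Core.AlmostCommutativeRing using (AlmostCommutativeRing; fromCommutativeRing)

open CommutativeSemigroup +-commutativeSemigroup using (interchange; x∙yz≈y∙xz)
open CommutativeSemigroup *-commutativeSemigroup using () renaming (x∙yz≈y∙xz to x*[y*z]≡y*[x*z])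

-- Finite sums

-- Every node over I keeps exactly k branches, so the next letter of x matches with probability k /
-- t whatever happened before. Ignoring x once M matches are made leaves exactly d - M free choices
-- on every successful path; following it further would concentrate the walk on too few leaves. Both
-- fours are optimal. In the Sauer-Shelah count, weights k inside I and c k outside give the bound
-- ((1 + c) ^ 5 / c ^ 4) ^ d k ^ (4 d) t ^ d, least at c = 4, where a coordinate falls into I with
-- probability 1 / 5 and n / 5 is the typical size. There 5 ^ 5 / 4 ^ 4 < 2 ^ 4, and |S| = (2 k) ^
-- (4 d) t ^ d. In the tail bound, c ^ M exp (-4 M (1 - 1 / c)) is least at c = 4, the ratio of mean
-- to threshold. It leaves 4 / e ^ 3 against 1 / 5; as e ^ 3 is only about 20.09, a fine rational
-- approximation of e is required. Probabilities are kept as natural numbers, multiplied by powers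
-- of k and t, and roots and exponentials are avoided by comparing integer powers. Rationals and
-- reals enter only at the end.

∑ : ∀ {A : Set} → List A → (A → ℕ) → ℕ
∑ []       f = 0
∑ (x ∷ xs) f = f x + ∑ xs f

⟦_⟧ : Bool → ℕ
⟦ b ⟧ = if b then 1 else 0

⟦⟧-∧ : ∀ b c → ⟦ b ∧ c ⟧ ≡ ⟦ b ⟧ * ⟦ c ⟧
⟦⟧-∧ true  c = sym (+-identityʳ ⟦ c ⟧)
⟦⟧-∧ false c = refl

⟦⟧≤1 : ∀ b → ⟦ b ⟧ ≤ 1
⟦⟧≤1 true  = ≤-refl
⟦⟧≤1 false = z≤n

⟦⟧-mono : ∀ b {c} → (b ≡ true → c ≡ true) → ⟦ b ⟧ ≤ ⟦ c ⟧
⟦⟧-mono true  h rewrite h refl = ≤-refl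
⟦⟧-mono false h = z≤n

≤ᵇ-true : ∀ {m n} → m ≤ n → (m ≤ᵇ n) ≡ true
≤ᵇ-true m≤n = Equivalence.to T-≡ (≤⇒≤ᵇ m≤n)

≤ᵇ-true⁻¹ : ∀ {m n} → (m ≤ᵇ n) ≡ true → m ≤ n
≤ᵇ-true⁻¹ {m} {n} eq = ≤ᵇ⇒≤ m n (Equivalence.from T-≡ eq)

module _ {A : Set} where

  ∑-mono : ∀ (xs : List A) {f g : A → ℕ} → (∀ x → f x ≤ g x) → ∑ xs f ≤ ∑ xs g
  ∑-mono []       f≤g = z≤n
  ∑-mono (x ∷ xs) f≤g = +-mono-≤ (f≤g x) (∑-mono xs f≤g)

  ∑-cong : ∀ (xs : List A) {f g : A → ℕ} → (∀ x → f x ≡ g x) → ∑ xs f ≡ ∑ xs g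
  ∑-cong []       f≗g = refl
  ∑-cong (x ∷ xs) f≗g = cong₂ _+_ (f≗g x) (∑-cong xs f≗g)

  ∑-zero : ∀ (xs : List A) → ∑ xs (λ _ → 0) ≡ 0
  ∑-zero []       = refl
  ∑-zero (x ∷ xs) = ∑-zero xs

  ∑-const : ∀ (xs : List A) c → ∑ xs (λ _ → c) ≡ length xs * c
  ∑-const []       c = refl
  ∑-const (x ∷ xs) c = cong (_+_ c) (∑-const xs c)

  ∑-+ : ∀ (xs : List A) (f g : A → ℕ) → ∑ xs (λ x → f x + g x) ≡ ∑ xs f + ∑ xs g
  ∑-+ []       f g = refl
  ∑-+ (x ∷ xs) f g = trans (cong (_+_ (f x + g x)) (∑-+ xs f g)) (interchange (f x) (g x) (∑ xs f) (∑ xs g))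

  *-distribˡ-∑ : ∀ c (xs : List A) (f : A → ℕ) → c * ∑ xs f ≡ ∑ xs (λ x → c * f x)
  *-distribˡ-∑ c []       f = *-zeroʳ c
  *-distribˡ-∑ c (x ∷ xs) f = trans (*-distribˡ-+ c (f x) (∑ xs f)) (cong (_+_ (c * f x)) (*-distribˡ-∑ c xs f))

  *-distribʳ-∑ : ∀ c (xs : List A) (f : A → ℕ) → ∑ xs f * c ≡ ∑ xs (λ x → f x * c)
  *-distribʳ-∑ c []       f = refl
  *-distribʳ-∑ c (x ∷ xs) f = trans (*-distribʳ-+ c (f x) (∑ xs f)) (cong (_+_ (f x * c)) (*-distribʳ-∑ c xs f))

  ∑-++ : ∀ (xs ys : List A) (f : A → ℕ) → ∑ (xs ++ ys) f ≡ ∑ xs f + ∑ ys f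
  ∑-++ []       ys f = refl
  ∑-++ (x ∷ xs) ys f = trans (cong (_+_ (f x)) (∑-++ xs ys f)) (sym (+-assoc (f x) (∑ xs f) (∑ ys f)))

  length-filterᵇ : ∀ (p : A → Bool) xs → length (filterᵇ p xs) ≡ ∑ xs (⟦_⟧ ∘ p)
  length-filterᵇ p []       = refl
  length-filterᵇ p (x ∷ xs) with p x
  ... | true  = cong suc (length-filterᵇ p xs)
  ... | false = length-filterᵇ p xs

  ∑-if : ∀ (xs : List A) (p : A → Bool) u v →
         ∑ xs (λ x → if p x then u else v) + ∑ xs (⟦_⟧ ∘ p) * v ≡ ∑ xs (⟦_⟧ ∘ p) * u + length xs * v
  ∑-if []       p u v = refl
  ∑-if (x ∷ xs) p u v with p x
  ... | true  = trans (interchange u (∑ xs _) v (∑ xs (⟦_⟧ ∘ p) * v))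
                  (trans (cong (_+_ (u + v)) (∑-if xs p u v))
                         (interchange u v (∑ xs (⟦_⟧ ∘ p) * u) (length xs * v)))
  ... | false = trans (+-assoc v (∑ xs _) _)
                  (trans (cong (_+_ v) (∑-if xs p u v))
                         (x∙yz≈y∙xz v (∑ xs (⟦_⟧ ∘ p) * u) (length xs * v)))

∑-map : ∀ {A B : Set} (g : A → B) xs (f : B → ℕ) → ∑ (map g xs) f ≡ ∑ xs (f ∘ g)
∑-map g []       f = refl
∑-map g (x ∷ xs) f = cong (_+_ (f (g x))) (∑-map g xs f)

∑-cartesianProductWith : ∀ {A B C : Set} (g : A → B → C) xs ys (f : C → ℕ) →
                         ∑ (cartesianProductWith g xs ys) f ≡ ∑ xs (λ x → ∑ ys (λ y → f (g x y)))
∑-cartesianProductWith g []       ys f = refl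
∑-cartesianProductWith g (x ∷ xs) ys f = trans (∑-++ (map (g x) ys) _ f)
  (cong₂ _+_ (∑-map (g x) ys f) (∑-cartesianProductWith g xs ys f))

∑-swap : ∀ {A B : Set} (xs : List A) (ys : List B) (f : A → B → ℕ) →
         ∑ xs (λ x → ∑ ys (f x)) ≡ ∑ ys (λ y → ∑ xs (λ x → f x y))
∑-swap []       ys f = sym (∑-zero ys)
∑-swap (x ∷ xs) ys f = trans (cong (_+_ (∑ ys (f x))) (∑-swap xs ys f)) (sym (∑-+ ys (f x) _))

∑-tabulate : ∀ {A : Set} {n} (g : Fin n → A) (f : A → ℕ) → ∑ (tabulate g) f ≡ ∑ (allFin n) (f ∘ g)
∑-tabulate {n = zero}  g f = refl
∑-tabulate {n = suc n} g f = cong (_+_ (f (g zero)))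
  (trans (∑-tabulate (g ∘ suc) f) (sym (∑-tabulate suc (f ∘ g))))

-- Letters, branches and slices

count : ∀ {t} → (Fin t → Bool) → ℕ
count P = ∑ (allFin _) (⟦_⟧ ∘ P)

count-suc : ∀ {t} (P : Fin (suc t) → Bool) → count P ≡ ⟦ P zero ⟧ + count (P ∘ suc)
count-suc P = cong (_+_ (⟦ P zero ⟧)) (∑-tabulate suc (⟦_⟧ ∘ P))

∑-allFin-≥ : ∀ {t} (f : Fin t → ℕ) i → f i ≤ ∑ (allFin t) f
∑-allFin-≥ {suc t} f zero    = m≤m+n _ _
∑-allFin-≥ {suc t} f (suc i) = ≤-trans (∑-allFin-≥ (f ∘ suc) i)
  (≤-trans (≤-reflexive (sym (∑-tabulate suc f))) (m≤n+m _ _))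

-- Prunes a node to exactly `w` branches. With a varying number of them the leaves would not number
-- `k ^ |I|`, and the chance of a match would depend on the node.
first : ∀ {t} → ℕ → (Fin t → Bool) → Fin t → Bool
first zero    P _       = false
first (suc w) P zero    = P zero
first (suc w) P (suc i) = first (if P zero then w else suc w) (P ∘ suc) i

first⊆ : ∀ {t} w (P : Fin t → Bool) i → first w P i ≡ true → P i ≡ true
first⊆ zero    P i       ()
first⊆ (suc w) P zero    h = h
first⊆ (suc w) P (suc i) h = first⊆ (if P zero then w else suc w) (P ∘ suc) i h

count-first : ∀ {t} w (P : Fin t → Bool) → w ≤ count P → count (first w P) ≡ w
count-first {t}     zero    P h = ∑-zero (allFin t)
count-first {zero}  (suc w) P ()
count-first {suc t} (suc w) P h =
  trans (count-suc (first (suc w) P)) (step (P zero) (≤-trans h (≤-reflexive (count-suc P))))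
  where
  step : ∀ b → suc w ≤ ⟦ b ⟧ + count (P ∘ suc) →
         ⟦ b ⟧ + count (first (if b then w else suc w) (P ∘ suc)) ≡ suc w
  step true  w<  = cong suc (count-first w (P ∘ suc) (s≤s⁻¹ w<))
  step false w<  = count-first (suc w) (P ∘ suc) w<

card≡∑ : ∀ {t n} (S : PointSet t n) → card S ≡ ∑ (points t n) (⟦_⟧ ∘ S)
card≡∑ {t} {n} S = length-filterᵇ S (points t n)

slice : ∀ {t n} → PointSet t (suc n) → Fin t → PointSet t n
slice S a x = S (a ∷ x)

∑-points-suc : ∀ {t n} (f : Point t (suc n) → ℕ) →
               ∑ (points t (suc n)) f ≡ ∑ (allFin t) (λ a → ∑ (points t n) (λ x → f (a ∷ x)))
∑-points-suc {t} {n} f = ∑-cartesianProductWith _∷_ (allFin t) (points t n) f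

card-suc : ∀ {t n} (S : PointSet t (suc n)) → card S ≡ ∑ (allFin t) (λ a → card (slice S a))
card-suc {t} {n} S = trans (card≡∑ S) (trans (∑-points-suc (⟦_⟧ ∘ S))
  (∑-cong (allFin t) λ a → sym (card≡∑ (slice S a))))

∑-points-const : ∀ t n c → ∑ (points t n) (λ _ → c) ≡ t ^ n * c
∑-points-const t zero    c = refl
∑-points-const t (suc n) c = begin
  ∑ (points t (suc n)) (λ _ → c)                 ≡⟨ ∑-points-suc {t} {n} (λ _ → c) ⟩
  ∑ (allFin t) (λ a → ∑ (points t n) (λ _ → c))  ≡⟨ ∑-cong (allFin t) (λ _ → ∑-points-const t n c) ⟩
  ∑ (allFin t) (λ a → t ^ n * c)                 ≡⟨ ∑-const (allFin t) (t ^ n * c) ⟩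
  length (allFin t) * (t ^ n * c)                ≡⟨ cong (_* (t ^ n * c)) (length-tabulate {n = t} (λ i → i)) ⟩
  t * (t ^ n * c)                                ≡⟨ *-assoc t (t ^ n) c ⟨
  t ^ suc n * c                                  ∎
  where
  open ≡-Reasoning

-- Shattering and trees

width : ℕ → Bool → ℕ
width k b = if b then k else 1

-- The branches at a node may continue with different letters at the coordinates outside `I`. This
-- freedom lets the slices be treated independently in the induction behind `card≤∑-shattered`.
shatters : ∀ {t n} → ℕ → PointSet t n → Subset n → Bool
shatters k S []      = S []
shatters k S (b ∷ I) = width k b ≤ᵇ count (λ a → shatters k (slice S a) I)

branch : ∀ {t n} → ℕ → PointSet t (suc n) → Bool → Subset n → Fin t → Bool
branch k S b I = first (width k b) (λ a → shatters k (slice S a) I)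

tree : ∀ {t n} → ℕ → PointSet t n → Subset n → PointSet t n
tree k S []      x       = S x
tree k S (b ∷ I) (a ∷ x) = branch k S b I a ∧ tree k (slice S a) I x

module _ (k : ℕ) where

  branch-shatters : ∀ {t n} (S : PointSet t (suc n)) b I a →
                    branch k S b I a ≡ true → shatters k (slice S a) I ≡ true
  branch-shatters S b I = first⊆ (width k b) (λ a → shatters k (slice S a) I)

  count-branch : ∀ {t n} (S : PointSet t (suc n)) b I → shatters k S (b ∷ I) ≡ true →
                 count (branch k S b I) ≡ width k b
  count-branch S b I sh = count-first (width k b) (λ a → shatters k (slice S a) I) (≤ᵇ-true⁻¹ sh)

  tree⊆ : ∀ {t n} (S : PointSet t n) I → tree k S I ⊆ S
  tree⊆ S []      x       h = h
  tree⊆ S (b ∷ I) (a ∷ x) h with branch k S b I a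
  ... | true = tree⊆ (slice S a) I x h

  ∑-branch-mono : ∀ {t n} (S : PointSet t (suc n)) b I {f g : Fin t → ℕ} →
                  (∀ a → shatters k (slice S a) I ≡ true → f a ≤ g a) →
                  ∑ (allFin t) (λ a → ⟦ branch k S b I a ⟧ * f a) ≤ ∑ (allFin t) (λ a → ⟦ branch k S b I a ⟧ * g a)
  ∑-branch-mono {t} S b I {f} {g} h = ∑-mono (allFin t) λ a → step a (branch k S b I a) refl
    where
    step : ∀ a c → branch k S b I a ≡ c → ⟦ c ⟧ * f a ≤ ⟦ c ⟧ * g a
    step a true  eq = *-monoʳ-≤ 1 (h a (branch-shatters S b I a eq))
    step a false eq = z≤n

  ∑-branch-const : ∀ {t n} (S : PointSet t (suc n)) b I → shatters k S (b ∷ I) ≡ true → ∀ c →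
                   ∑ (allFin t) (λ a → ⟦ branch k S b I a ⟧ * c) ≡ width k b * c
  ∑-branch-const {t} S b I sh c = trans (sym (*-distribʳ-∑ c (allFin t) _)) (cong (_* c) (count-branch S b I sh))

  card-∧ : ∀ {t n} c (A : PointSet t n) → card (λ x → c ∧ A x) ≡ ⟦ c ⟧ * card A
  card-∧ {t} {n} c A = begin
    card (λ x → c ∧ A x)                    ≡⟨ card≡∑ (λ x → c ∧ A x) ⟩
    ∑ (points t n) (λ x → ⟦ c ∧ A x ⟧)      ≡⟨ ∑-cong (points t n) (λ x → ⟦⟧-∧ c (A x)) ⟩
    ∑ (points t n) (λ x → ⟦ c ⟧ * ⟦ A x ⟧)  ≡⟨ *-distribˡ-∑ ⟦ c ⟧ (points t n) (⟦_⟧ ∘ A) ⟨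
    ⟦ c ⟧ * ∑ (points t n) (⟦_⟧ ∘ A)        ≡⟨ cong (⟦ c ⟧ *_) (card≡∑ A) ⟨
    ⟦ c ⟧ * card A                          ∎
    where open ≡-Reasoning

  width-^ : ∀ {n} b (I : Subset n) → width k b * k ^ ∣ I ∣ ≡ k ^ ∣ b ∷ I ∣
  width-^ true  I = refl
  width-^ false I = +-identityʳ _

  card-tree : ∀ {t n} (S : PointSet t n) I → shatters k S I ≡ true → card (tree k S I) ≡ k ^ ∣ I ∣
  card-tree S []      sh rewrite sh = refl
  card-tree {t} S (b ∷ I) sh = begin
    card (tree k S (b ∷ I))
      ≡⟨ card-suc (tree k S (b ∷ I)) ⟩
    ∑ (allFin t) (λ a → card (slice (tree k S (b ∷ I)) a))
      ≡⟨ ∑-cong (allFin t) (λ a → trans (card-∧ (branch k S b I a) (tree k (slice S a) I)) (step a (branch k S b I a) refl)) ⟩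
    ∑ (allFin t) (λ a → ⟦ branch k S b I a ⟧ * k ^ ∣ I ∣)
      ≡⟨ ∑-branch-const S b I sh (k ^ ∣ I ∣) ⟩
    width k b * k ^ ∣ I ∣
      ≡⟨ width-^ b I ⟩
    k ^ ∣ b ∷ I ∣
      ∎
    where
    open ≡-Reasoning
    step : ∀ a c → branch k S b I a ≡ c → ⟦ c ⟧ * card (tree k (slice S a) I) ≡ ⟦ c ⟧ * k ^ ∣ I ∣
    step a true  eq = cong (1 *_) (card-tree (slice S a) I (branch-shatters S b I a eq))
    step a false eq = refl

  -- k ^ |I| times the probability that the walk guided by x makes fewer than m
  -- matches on its way down tree k S I.
  deficit : ∀ {t n} → PointSet t n → Subset n → ℕ → Point t n → ℕ
  deficit     S I           zero    x       = 0
  deficit     S []          (suc m) x       = 1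
  deficit {t} S (false ∷ I) (suc m) (y ∷ x) = ∑ (allFin t) (λ a → ⟦ branch k S false I a ⟧ * deficit (slice S a) I (suc m) x)
  deficit {t} S (true ∷ I)  (suc m) (y ∷ x) =
    if branch k S true I y
    then k * deficit (slice S y) I m x
    else ∑ (allFin t) (λ a → ⟦ branch k S true I a ⟧ * deficit (slice S a) I (suc m) x)

  hits : ∀ {t n} → PointSet t n → Subset n → ℕ → Point t n → ℕ
  hits S I m x = card (N[ tree k S I , I , m ] x)

  Match-true : ∀ {t n} (I : Subset n) (y a : Fin t) (x x′ : Point t n) →
               Match (true ∷ I) (y ∷ x) (a ∷ x′) ≡ ⟦ does (y Fin.≟ a) ⟧ + Match I x x′
  Match-true I y a x x′ with does (y Fin.≟ a)
  ... | true  = refl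
  ... | false = refl

  Match-cons-≥ : ∀ {t n} b (I : Subset n) (y a : Fin t) (x x′ : Point t n) →
                 Match I x x′ ≤ Match (b ∷ I) (y ∷ x) (a ∷ x′)
  Match-cons-≥ false I y a x x′ = ≤-refl
  Match-cons-≥ true  I y a x x′ = ≤-trans (m≤n+m _ _) (≤-reflexive (sym (Match-true I y a x x′)))

  Match-true-≡ : ∀ {t n} (I : Subset n) (y : Fin t) (x x′ : Point t n) →
                 Match (true ∷ I) (y ∷ x) (y ∷ x′) ≡ suc (Match I x x′)
  Match-true-≡ I y x x′ with y Fin.≟ y
  ... | yes _  = refl
  ... | no y≢y = contradiction refl y≢y

  card-mono : ∀ {t n} {A B : PointSet t n} → A ⊆ B → card A ≤ card B
  card-mono {t} {n} {A} {B} A⊆B = ≤-trans (≤-reflexive (card≡∑ A))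
    (≤-trans (∑-mono (points t n) (λ x → ⟦⟧-mono (A x) (A⊆B x))) (≤-reflexive (sym (card≡∑ B))))

  -- Two thresholds let one lemma serve both kinds of move: `m′ = m` for a free move, where a match
  -- is not counted, and `m′ = suc m` for the forced move along the letter of `x`.
  hits-branch : ∀ {t n} (S : PointSet t (suc n)) b I a y x m m′ →
                (∀ x′ → m ≤ Match I x x′ → m′ ≤ Match (b ∷ I) (y ∷ x) (a ∷ x′)) →
                ⟦ branch k S b I a ⟧ * hits (slice S a) I m x ≤ card (slice (N[ tree k S (b ∷ I) , b ∷ I , m′ ] (y ∷ x)) a)
  hits-branch S b I a y x m m′ h with branch k S b I a
  ... | false = z≤n
  ... | true  = ≤-trans (≤-reflexive (+-identityʳ _)) (card-mono λ x′ → step x′ (tree k (slice S a) I x′))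
    where
    step : ∀ x′ c → (c ∧ (m ≤ᵇ Match I x x′)) ≡ true → (c ∧ (m′ ≤ᵇ Match (b ∷ I) (y ∷ x) (a ∷ x′))) ≡ true
    step x′ true m≤ = ≤ᵇ-true (h x′ (≤ᵇ-true⁻¹ m≤))

  ∑-hits≤ : ∀ {t n} (S : PointSet t (suc n)) b I y x m →
            ∑ (allFin t) (λ a → ⟦ branch k S b I a ⟧ * hits (slice S a) I m x) ≤ hits S (b ∷ I) m (y ∷ x)
  ∑-hits≤ {t} S b I y x m = ≤-trans
    (∑-mono (allFin t) λ a → hits-branch S b I a y x m m λ x′ m≤ → ≤-trans m≤ (Match-cons-≥ b I y a x x′))
    (≤-reflexive (sym (card-suc (N[ tree k S (b ∷ I) , b ∷ I , m ] (y ∷ x)))))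

  hits-match≤ : ∀ {t n} (S : PointSet t (suc n)) I y x m → branch k S true I y ≡ true →
                hits (slice S y) I m x ≤ hits S (true ∷ I) (suc m) (y ∷ x)
  hits-match≤ S I y x m eq = begin
    hits (slice S y) I m x                            ≡⟨ *-identityˡ _ ⟨
    1 * hits (slice S y) I m x                        ≡⟨ cong (λ c → ⟦ c ⟧ * hits (slice S y) I m x) eq ⟨
    ⟦ branch k S true I y ⟧ * hits (slice S y) I m x  ≤⟨ hits-branch S true I y y x m (suc m) (λ x′ m≤ →
                                                                ≤-trans (s≤s m≤) (≤-reflexive (sym (Match-true-≡ I y x x′)))) ⟩
    card (slice N′ y)                       ≤⟨ ∑-allFin-≥ (λ a → card (slice N′ a)) y ⟩
    ∑ (allFin _) (λ a → card (slice N′ a))  ≡⟨ card-suc N′ ⟨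
    hits S (true ∷ I) (suc m) (y ∷ x)       ∎
    where
    open ≤-Reasoning
    N′ = N[ tree k S (true ∷ I) , true ∷ I , suc m ] (y ∷ x)

  -- A free move splits both terms evenly among the branches. A forced move sees only the leaves
  -- behind one branch; the factor `k` missing from their number is the one by which `k ^ suc m`
  -- exceeds `k ^ m`.
  deficit-bound : ∀ {t n} (S : PointSet t n) I m x → shatters k S I ≡ true →
                  k ^ ∣ I ∣ ≤ deficit S I m x + k ^ m * hits S I m x

  ∑-deficit-bound : ∀ {t n} (S : PointSet t (suc n)) b I m y x → shatters k S (b ∷ I) ≡ true →
                    k ^ ∣ b ∷ I ∣ ≤ ∑ (allFin t) (λ a → ⟦ branch k S b I a ⟧ * deficit (slice S a) I m x)
                                    + k ^ m * hits S (b ∷ I) m (y ∷ x)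
  ∑-deficit-bound {t} S b I m y x sh = begin
    k ^ ∣ b ∷ I ∣
      ≡⟨ width-^ b I ⟨
    width k b * k ^ ∣ I ∣
      ≡⟨ ∑-branch-const S b I sh (k ^ ∣ I ∣) ⟨
    ∑ (allFin t) (λ a → β a * k ^ ∣ I ∣)
      ≤⟨ ∑-branch-mono S b I (λ a → deficit-bound (slice S a) I m x) ⟩
    ∑ (allFin t) (λ a → β a * (δ a + k ^ m * η a))
      ≡⟨ ∑-cong (allFin t) (λ a → distrib (β a) (δ a) (k ^ m) (η a)) ⟩
    ∑ (allFin t) (λ a → β a * δ a + k ^ m * (β a * η a))
      ≡⟨ ∑-+ (allFin t) _ _ ⟩
    ∑ (allFin t) (λ a → β a * δ a) + ∑ (allFin t) (λ a → k ^ m * (β a * η a))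
      ≡⟨ cong (_+_ (∑ (allFin t) (λ a → β a * δ a))) (*-distribˡ-∑ (k ^ m) (allFin t) (λ a → β a * η a)) ⟨
    ∑ (allFin t) (λ a → β a * δ a) + k ^ m * ∑ (allFin t) (λ a → β a * η a)
      ≤⟨ +-monoʳ-≤ _ (*-monoʳ-≤ (k ^ m) (∑-hits≤ S b I y x m)) ⟩
    ∑ (allFin t) (λ a → β a * δ a) + k ^ m * hits S (b ∷ I) m (y ∷ x)
      ∎
    where
    open ≤-Reasoning
    β δ η : Fin t → ℕ
    β a = ⟦ branch k S b I a ⟧
    δ a = deficit (slice S a) I m x
    η a = hits (slice S a) I m x
    distrib : ∀ b d c e → b * (d + c * e) ≡ b * d + c * (b * e)
    distrib = solve-∀

  deficit-bound S I zero x sh = begin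
    k ^ ∣ I ∣             ≡⟨ card-tree S I sh ⟨
    card (tree k S I)     ≤⟨ card-mono {A = tree k S I} {N[ tree k S I , I , 0 ] x} (λ x′ → cong (_∧ true)) ⟩
    hits S I 0 x          ≡⟨ +-identityʳ _ ⟨
    k ^ 0 * hits S I 0 x  ∎
    where open ≤-Reasoning
  deficit-bound S []          (suc m) x sh = s≤s z≤n
  deficit-bound S (false ∷ I) (suc m) (y ∷ x) sh = ∑-deficit-bound S false I (suc m) y x sh
  deficit-bound {t} S (true ∷ I)  (suc m) (y ∷ x) sh = step (branch k S true I y) refl
    where
    open ≤-Reasoning
    step : ∀ c → branch k S true I y ≡ c →
           k ^ suc ∣ I ∣ ≤ (if c then k * deficit (slice S y) I m x
                            else ∑ (allFin t) (λ a → ⟦ branch k S true I a ⟧ * deficit (slice S a) I (suc m) x))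
                           + k ^ suc m * hits S (true ∷ I) (suc m) (y ∷ x)
    step false eq = ∑-deficit-bound S true I (suc m) y x sh
    step true  eq = begin
      k * k ^ ∣ I ∣
        ≤⟨ *-monoʳ-≤ k (deficit-bound (slice S y) I m x (branch-shatters S true I y eq)) ⟩
      k * (deficit (slice S y) I m x + k ^ m * hits (slice S y) I m x)
        ≡⟨ distrib k (deficit (slice S y) I m x) (k ^ m) (hits (slice S y) I m x) ⟩
      k * deficit (slice S y) I m x + k * k ^ m * hits (slice S y) I m x
        ≤⟨ +-monoʳ-≤ _ (*-monoʳ-≤ (k ^ suc m) (hits-match≤ S I y x m eq)) ⟩
      k * deficit (slice S y) I m x + k ^ suc m * hits S (true ∷ I) (suc m) (y ∷ x)
        ∎
      where
      distrib : ∀ k d c e → k * (d + c * e) ≡ k * d + k * c * e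
      distrib = solve-∀

  -- t = k + s avoids truncated subtraction: (k + 4 s) / 4 t is 1 - 3 k / 4 t, the
  -- mean of 4 ^ -[match] at one level.
  module _ (s : ℕ) where

    private
      t : ℕ
      t = k + s

      B : ℕ → ℕ → ℕ → ℕ
      B h n m = 4 ^ m * ((k + 4 * s) ^ h * k ^ h * t ^ n)

    -- Markov's inequality for 4 ^ -[match], unrolled along the tree. At a coordinate of `I`, `k`
    -- letters match and lower the threshold, which saves a factor 4, and the other `s` letters do
    -- not; together they contribute the factor `k + 4 * s`.
    ∑-deficit : ∀ {n} (S : PointSet t n) I m → shatters k S I ≡ true →
                (4 * t) ^ ∣ I ∣ * ∑ (points t n) (deficit S I m) ≤ B ∣ I ∣ n m

    ∑∑-branch : ∀ {n} (S : PointSet t (suc n)) b I m → shatters k S (b ∷ I) ≡ true →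
                (4 * t) ^ ∣ I ∣ * ∑ (points t n) (λ x → ∑ (allFin t) (λ a → ⟦ branch k S b I a ⟧ * deficit (slice S a) I m x))
                  ≤ width k b * B ∣ I ∣ n m
    ∑∑-branch {n} S b I m sh = begin
      Y * ∑ (points t n) (λ x → ∑ (allFin t) (λ a → β a * deficit (slice S a) I m x))
        ≡⟨ cong (Y *_) (∑-swap (points t n) (allFin t) _) ⟩
      Y * ∑ (allFin t) (λ a → ∑ (points t n) (λ x → β a * deficit (slice S a) I m x))
        ≡⟨ cong (Y *_) (∑-cong (allFin t) (λ a → *-distribˡ-∑ (β a) (points t n) _)) ⟨
      Y * ∑ (allFin t) (λ a → β a * D a)
        ≡⟨ *-distribˡ-∑ Y (allFin t) _ ⟩
      ∑ (allFin t) (λ a → Y * (β a * D a))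
        ≡⟨ ∑-cong (allFin t) (λ a → x*[y*z]≡y*[x*z] Y (β a) (D a)) ⟩
      ∑ (allFin t) (λ a → β a * (Y * D a))
        ≤⟨ ∑-branch-mono S b I (λ a → ∑-deficit (slice S a) I m) ⟩
      ∑ (allFin t) (λ a → β a * B ∣ I ∣ n m)
        ≡⟨ ∑-branch-const S b I sh _ ⟩
      width k b * B ∣ I ∣ n m
        ∎
      where
      open ≤-Reasoning
      Y = (4 * t) ^ ∣ I ∣
      β D : Fin t → ℕ
      β a = ⟦ branch k S b I a ⟧
      D a = ∑ (points t n) (deficit (slice S a) I m)

    ∑-deficit {n} S I zero sh = begin
      (4 * t) ^ ∣ I ∣ * ∑ (points t n) (λ _ → 0)  ≡⟨ cong ((4 * t) ^ ∣ I ∣ *_) (∑-zero (points t n)) ⟩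
      (4 * t) ^ ∣ I ∣ * 0                         ≡⟨ *-zeroʳ ((4 * t) ^ ∣ I ∣) ⟩
      0                                           ≤⟨ z≤n ⟩
      B ∣ I ∣ n 0                                 ∎
      where open ≤-Reasoning
    ∑-deficit S []          (suc m) sh = ≤-trans (m^n>0 4 (suc m)) (≤-reflexive (sym (*-identityʳ _)))
    ∑-deficit {suc n} S (false ∷ I) (suc m) sh = begin
      Y * ∑ (points t (suc n)) (deficit S (false ∷ I) (suc m))
        ≡⟨ cong (Y *_) (∑-points-suc (deficit S (false ∷ I) (suc m))) ⟩
      Y * ∑ (allFin t) (λ _ → E)
        ≡⟨ cong (Y *_) (∑-const (allFin t) E) ⟩
      Y * (length (allFin t) * E)
        ≡⟨ cong (λ l → Y * (l * E)) (length-tabulate {n = t} (λ i → i)) ⟩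
      Y * (t * E)
        ≡⟨ x*[y*z]≡y*[x*z] Y t E ⟩
      t * (Y * E)
        ≤⟨ *-monoʳ-≤ t (∑∑-branch S false I (suc m) sh) ⟩
      t * (1 * B ∣ I ∣ n (suc m))
        ≡⟨ regroup t (4 ^ suc m) ((k + 4 * s) ^ ∣ I ∣ * k ^ ∣ I ∣) (t ^ n) ⟩
      B ∣ I ∣ (suc n) (suc m)
        ∎
      where
      open ≤-Reasoning
      Y = (4 * t) ^ ∣ I ∣
      E = ∑ (points t n) (λ x → ∑ (allFin t) (λ a → ⟦ branch k S false I a ⟧ * deficit (slice S a) I (suc m) x))
      regroup : ∀ t f x p → t * (1 * (f * (x * p))) ≡ f * (x * (t * p))
      regroup = solve-∀
    ∑-deficit {suc n} S (true ∷ I) (suc m) sh = begin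
      4 * t * Y * ∑ (points t (suc n)) (deficit S (true ∷ I) (suc m))
        ≡⟨ cong (4 * t * Y *_) (∑-points-suc (deficit S (true ∷ I) (suc m))) ⟩
      4 * t * Y * ∑ (allFin t) (λ y → ∑ (points t n) (λ x → deficit S (true ∷ I) (suc m) (y ∷ x)))
        ≡⟨ *-assoc (4 * t) Y _ ⟩
      4 * t * (Y * ∑ (allFin t) (λ y → ∑ (points t n) (λ x → deficit S (true ∷ I) (suc m) (y ∷ x))))
        ≡⟨ cong (4 * t *_) (*-distribˡ-∑ Y (allFin t) _) ⟩
      4 * t * ∑ (allFin t) (λ y → Y * ∑ (points t n) (λ x → deficit S (true ∷ I) (suc m) (y ∷ x)))
        ≤⟨ *-monoʳ-≤ (4 * t) (∑-mono (allFin t) (λ y → step y (branch k S true I y) refl)) ⟩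
      4 * t * W
        ≡⟨ cong (4 * t *_) W≡ ⟩
      4 * t * (k * (k * b) + s * (k * (4 * b)))
        ≡⟨ regroup k s (4 ^ m) ((k + 4 * s) ^ ∣ I ∣) (k ^ ∣ I ∣) (t ^ n) ⟩
      B (suc ∣ I ∣) (suc n) (suc m)
        ∎
      where
      open ≤-Reasoning
      Y = (4 * t) ^ ∣ I ∣
      b = B ∣ I ∣ n m
      W = ∑ (allFin t) (λ y → if branch k S true I y then k * b else k * (4 * b))
      regroup : ∀ k s f p q r →
                4 * (k + s) * (k * (k * (f * (p * q * r))) + s * (k * (4 * (f * (p * q * r)))))
                ≡ 4 * f * ((k + 4 * s) * p * (k * q) * ((k + s) * r))
      regroup = solve-∀
      B-suc : B ∣ I ∣ n (suc m) ≡ 4 * b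
      B-suc = *-assoc 4 (4 ^ m) _
      split : ∀ k s u v → k * u + (k + s) * v ≡ k * u + s * v + k * v
      split = solve-∀
      W≡ : W ≡ k * (k * b) + s * (k * (4 * b))
      -- `∑-if` charges all `t` letters with the unmatched value, so the excess for the `k` matching
      -- letters is added on the left and cancelled rather than subtracted.
      W≡ = +-cancelʳ-≡ (k * (k * (4 * b))) _ _ (begin-equality
        W + k * (k * (4 * b))
          ≡⟨ cong (λ c → W + c * (k * (4 * b))) (count-branch S true I sh) ⟨
        W + count (branch k S true I) * (k * (4 * b))
          ≡⟨ ∑-if (allFin t) (branch k S true I) (k * b) (k * (4 * b)) ⟩
        count (branch k S true I) * (k * b) + length (allFin t) * (k * (4 * b))
          ≡⟨ cong₂ (λ c l → c * (k * b) + l * (k * (4 * b))) (count-branch S true I sh) (length-tabulate {n = t} (λ i → i)) ⟩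
        k * (k * b) + t * (k * (4 * b))
          ≡⟨ split k s (k * b) (k * (4 * b)) ⟩
        k * (k * b) + s * (k * (4 * b)) + k * (k * (4 * b))
          ∎)
      step : ∀ y c → branch k S true I y ≡ c →
             Y * ∑ (points t n) (λ x → if c
                                        then k * deficit (slice S y) I m x
                                        else ∑ (allFin t) (λ a → ⟦ branch k S true I a ⟧ * deficit (slice S a) I (suc m) x))
               ≤ (if c then k * b else k * (4 * b))
      step y true  eq = begin
        Y * ∑ (points t n) (λ x → k * deficit (slice S y) I m x)  ≡⟨ cong (Y *_) (*-distribˡ-∑ k (points t n) _) ⟨
        Y * (k * ∑ (points t n) (deficit (slice S y) I m))        ≡⟨ x*[y*z]≡y*[x*z] Y k _ ⟩
        k * (Y * ∑ (points t n) (deficit (slice S y) I m))        ≤⟨ *-monoʳ-≤ k (∑-deficit (slice S y) I m (branch-shatters S true I y eq)) ⟩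
        k * b                                                     ∎
      step y false eq = ≤-trans (∑∑-branch S true I (suc m) sh) (≤-reflexive (cong (k *_) B-suc))

-- The Sauer-Shelah count

weight : ∀ {n} → ℕ → ℕ → Subset n → ℕ
weight u v []          = 1
weight u v (true ∷ I)  = u * weight u v I
weight u v (false ∷ I) = v * weight u v I

subsets : ∀ n → List (Subset n)
subsets zero    = [] ∷ []
subsets (suc n) = cartesianProductWith _∷_ (true ∷ false ∷ []) (subsets n)

∑-subsets-suc : ∀ {n} (f : Subset (suc n) → ℕ) →
                ∑ (subsets (suc n)) f ≡ ∑ (subsets n) (f ∘ (true ∷_)) + ∑ (subsets n) (f ∘ (false ∷_))
∑-subsets-suc {n} f = trans (∑-cartesianProductWith _∷_ (true ∷ false ∷ []) (subsets n) f)
  (cong (_+_ (∑ (subsets n) (f ∘ (true ∷_)))) (+-identityʳ _))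

∑-weight : ∀ u v n → ∑ (subsets n) (weight u v) ≡ (u + v) ^ n
∑-weight u v zero    = refl
∑-weight u v (suc n) = begin
  ∑ (subsets (suc n)) (weight u v)
    ≡⟨ ∑-subsets-suc {n} (weight u v) ⟩
  ∑ (subsets n) (λ I → u * weight u v I) + ∑ (subsets n) (λ I → v * weight u v I)
    ≡⟨ cong₂ _+_ (*-distribˡ-∑ u (subsets n) (weight u v)) (*-distribˡ-∑ v (subsets n) (weight u v)) ⟨
  u * ∑ (subsets n) (weight u v) + v * ∑ (subsets n) (weight u v)
    ≡⟨ *-distribʳ-+ (∑ (subsets n) (weight u v)) u v ⟨
  (u + v) * ∑ (subsets n) (weight u v)
    ≡⟨ cong ((u + v) *_) (∑-weight u v n) ⟩
  (u + v) ^ suc n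
    ∎
  where open ≡-Reasoning

count≤ : ∀ {t} (P : Fin t → Bool) → count P ≤ t
count≤ {t} P = begin
  count P                 ≤⟨ ∑-mono (allFin t) (λ a → ⟦⟧≤1 (P a)) ⟩
  ∑ (allFin t) (λ _ → 1)  ≡⟨ ∑-const (allFin t) 1 ⟩
  length (allFin t) * 1   ≡⟨ *-identityʳ _ ⟩
  length (allFin t)       ≡⟨ length-tabulate {n = t} (λ i → i) ⟩
  t                       ∎
  where
  open ≤-Reasoning

-- The analogue of Pajor's strengthening of the Sauer–Shelah lemma.
card≤∑-shattered : ∀ {t n} k (S : PointSet t n) →
                   card S ≤ ∑ (subsets n) (λ I → ⟦ shatters k S I ⟧ * weight t k I)
card≤∑-shattered {t} {zero}  k S = ≤-reflexive (trans (card≡∑ S) (cong (_+ 0) (sym (*-identityʳ _))))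
card≤∑-shattered {t} {suc n} k S = begin
  card S
    ≡⟨ card-suc S ⟩
  ∑ (allFin t) (λ a → card (slice S a))
    ≤⟨ ∑-mono (allFin t) (λ a → card≤∑-shattered k (slice S a)) ⟩
  ∑ (allFin t) (λ a → ∑ (subsets n) (λ I → ⟦ shatters k (slice S a) I ⟧ * ω I))
    ≡⟨ ∑-swap (allFin t) (subsets n) _ ⟩
  ∑ (subsets n) (λ I → ∑ (allFin t) (λ a → ⟦ shatters k (slice S a) I ⟧ * ω I))
    ≡⟨ ∑-cong (subsets n) (λ I → *-distribʳ-∑ (ω I) (allFin t) _) ⟨
  ∑ (subsets n) (λ I → c I * ω I)
    ≤⟨ ∑-mono (subsets n) bound ⟩
  ∑ (subsets n) (λ I → ⟦ k ≤ᵇ c I ⟧ * (t * ω I) + ⟦ 1 ≤ᵇ c I ⟧ * (k * ω I))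
    ≡⟨ ∑-+ (subsets n) _ _ ⟩
  ∑ (subsets n) (λ I → ⟦ k ≤ᵇ c I ⟧ * (t * ω I)) + ∑ (subsets n) (λ I → ⟦ 1 ≤ᵇ c I ⟧ * (k * ω I))
    ≡⟨ ∑-subsets-suc (λ I → ⟦ shatters k S I ⟧ * weight t k I) ⟨
  ∑ (subsets (suc n)) (λ I → ⟦ shatters k S I ⟧ * weight t k I)
    ∎
  where
  open ≤-Reasoning
  ω : Subset n → ℕ
  ω = weight t k
  c : Subset n → ℕ
  c I = count (λ a → shatters k (slice S a) I)
  -- Of the `c I` slices shattering `I`, at least `k` make `true ∷ I` shattered, and their number is
  -- at most `t`; fewer than `k`, but at least one, still make `false ∷ I` shattered.
  bound : ∀ I → c I * ω I ≤ ⟦ k ≤ᵇ c I ⟧ * (t * ω I) + ⟦ 1 ≤ᵇ c I ⟧ * (k * ω I)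
  bound I with c I | count≤ (λ a → shatters k (slice S a) I)
  ... | zero  | _   = z≤n
  ... | suc m | c≤t with k ≤ᵇ suc m in eq
  ...   | true  = ≤-trans (*-monoˡ-≤ (ω I) c≤t) (≤-trans (≤-reflexive (sym (+-identityʳ _))) (m≤m+n _ _))
  ...   | false = ≤-trans (*-monoˡ-≤ (ω I) (<⇒≤ (≰⇒> {k} {suc m} λ k≤ → contradiction (trans (sym eq) (≤ᵇ-true k≤)) λ ())))
                          (≤-reflexive (sym (+-identityʳ _)))

∑-<⇒∃ : ∀ {A : Set} (xs : List A) {f g : A → ℕ} → ∑ xs f < ∑ xs g → ∃[ x ] f x < g x
∑-<⇒∃ (x ∷ xs) {f} {g} h with f x <? g x
... | yes fx<gx = x , fx<gx
... | no  fx≮gx = ∑-<⇒∃ xs (+-cancelˡ-< (f x) _ _ (<-≤-trans h (+-monoˡ-≤ _ (≮⇒≥ fx≮gx))))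

-- 4 ^ n (k / 4 t) ^ |I| is the exponential tilt that penalises small I; it turns
-- t ^ |I| k ^ (n - |I|) into another product weight.
weight-scale : ∀ {n} t k (I : Subset n) →
               weight t k I * 4 ^ n * k ^ ∣ I ∣ ≡ weight k (4 * k) I * (4 * t) ^ ∣ I ∣
weight-scale         t k []          = refl
weight-scale {suc n} t k (true ∷ I)  = begin
  t * weight t k I * (4 * 4 ^ n) * (k * k ^ ∣ I ∣)    ≡⟨ regroup t (weight t k I) (4 ^ n) k (k ^ ∣ I ∣) ⟩
  4 * t * k * (weight t k I * 4 ^ n * k ^ ∣ I ∣)      ≡⟨ cong (4 * t * k *_) (weight-scale t k I) ⟩
  4 * t * k * (weight k (4 * k) I * (4 * t) ^ ∣ I ∣)  ≡⟨ regroup′ (4 * t) k (weight k (4 * k) I) ((4 * t) ^ ∣ I ∣) ⟩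
  k * weight k (4 * k) I * (4 * t * (4 * t) ^ ∣ I ∣)  ∎
  where
  open ≡-Reasoning
  regroup : ∀ t w f k p → t * w * (4 * f) * (k * p) ≡ 4 * t * k * (w * f * p)
  regroup = solve-∀
  regroup′ : ∀ t k w p → t * k * (w * p) ≡ k * w * (t * p)
  regroup′ = solve-∀
weight-scale {suc n} t k (false ∷ I) = begin
  k * weight t k I * (4 * 4 ^ n) * k ^ ∣ I ∣      ≡⟨ regroup k (weight t k I) (4 ^ n) (k ^ ∣ I ∣) ⟩
  4 * k * (weight t k I * 4 ^ n * k ^ ∣ I ∣)      ≡⟨ cong (4 * k *_) (weight-scale t k I) ⟩
  4 * k * (weight k (4 * k) I * (4 * t) ^ ∣ I ∣)  ≡⟨ *-assoc (4 * k) _ _ ⟨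
  4 * k * weight k (4 * k) I * (4 * t) ^ ∣ I ∣    ∎
  where
  open ≡-Reasoning
  regroup : ∀ k w f p → k * w * (4 * f) * p ≡ 4 * k * (w * f * p)
  regroup = solve-∀

-- Raising the exponent of the tilt k / 4 t from |I| to `d` multiplies by further factors, each at
-- most 1.
weight-light : ∀ {n} t k d (I : Subset n) → k ≤ 4 * t → ∣ I ∣ ≤ d →
               weight t k I * (4 ^ n * k ^ d) ≤ weight k (4 * k) I * (4 * t) ^ d
weight-light {n} t k d I k≤4t i≤d = begin
  weight t k I * (4 ^ n * k ^ d)
    ≡⟨ cong (λ e → weight t k I * (4 ^ n * k ^ e)) (m+[n∸m]≡n i≤d) ⟨
  weight t k I * (4 ^ n * k ^ (∣ I ∣ + e))
    ≡⟨ cong (λ z → weight t k I * (4 ^ n * z)) (^-distribˡ-+-* k ∣ I ∣ e) ⟩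
  weight t k I * (4 ^ n * (k ^ ∣ I ∣ * k ^ e))
    ≡⟨ regroup (weight t k I) (4 ^ n) (k ^ ∣ I ∣) (k ^ e) ⟩
  weight t k I * 4 ^ n * k ^ ∣ I ∣ * k ^ e
    ≡⟨ cong (_* k ^ e) (weight-scale t k I) ⟩
  weight k (4 * k) I * (4 * t) ^ ∣ I ∣ * k ^ e
    ≤⟨ *-monoʳ-≤ (weight k (4 * k) I * (4 * t) ^ ∣ I ∣) (^-monoˡ-≤ e k≤4t) ⟩
  weight k (4 * k) I * (4 * t) ^ ∣ I ∣ * (4 * t) ^ e
    ≡⟨ *-assoc (weight k (4 * k) I) _ _ ⟩
  weight k (4 * k) I * ((4 * t) ^ ∣ I ∣ * (4 * t) ^ e)
    ≡⟨ cong (weight k (4 * k) I *_) (^-distribˡ-+-* (4 * t) ∣ I ∣ e) ⟨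
  weight k (4 * k) I * (4 * t) ^ (∣ I ∣ + e)
    ≡⟨ cong (λ e → weight k (4 * k) I * (4 * t) ^ e) (m+[n∸m]≡n i≤d) ⟩
  weight k (4 * k) I * (4 * t) ^ d
    ∎
  where
  open ≤-Reasoning
  e = d ∸ ∣ I ∣
  regroup : ∀ w f p q → w * (f * (p * q)) ≡ w * f * p * q
  regroup = solve-∀

-- If every shattered set had fewer than `d` elements, `weight-light` summed over all of them would
-- bound |S| by the total product weight `(5 * k) ^ n`, rescaled. The comparison is made termwise,
-- so a violating term is itself the set sought.
large⇒shatters : ∀ {t n} k d (S : PointSet t n) → k ≤ 4 * t →
                 (5 * k) ^ n * (4 * t) ^ d < card S * 4 ^ n * k ^ d →
                 ∃[ I ] (shatters k S I ≡ true × d ≤ ∣ I ∣)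
large⇒shatters {t} {n} k d S k≤4t large = I , proj₁ good , proj₂ good
  where
  open ≤-Reasoning
  c = 4 ^ n * k ^ d
  sums : ∑ (subsets n) (λ I → weight k (4 * k) I * (4 * t) ^ d) < ∑ (subsets n) (λ I → ⟦ shatters k S I ⟧ * weight t k I * c)
  sums = begin-strict
    ∑ (subsets n) (λ I → weight k (4 * k) I * (4 * t) ^ d)       ≡⟨ *-distribʳ-∑ ((4 * t) ^ d) (subsets n) _ ⟨
    ∑ (subsets n) (weight k (4 * k)) * (4 * t) ^ d               ≡⟨ cong (_* (4 * t) ^ d) (∑-weight k (4 * k) n) ⟩
    (5 * k) ^ n * (4 * t) ^ d                                    <⟨ large ⟩
    card S * 4 ^ n * k ^ d                                       ≡⟨ *-assoc (card S) (4 ^ n) (k ^ d) ⟩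
    card S * c                                                   ≤⟨ *-monoˡ-≤ c (card≤∑-shattered k S) ⟩
    ∑ (subsets n) (λ I → ⟦ shatters k S I ⟧ * weight t k I) * c  ≡⟨ *-distribʳ-∑ c (subsets n) _ ⟩
    ∑ (subsets n) (λ I → ⟦ shatters k S I ⟧ * weight t k I * c)  ∎
  I = proj₁ (∑-<⇒∃ (subsets n) sums)
  I-heavy : weight k (4 * k) I * (4 * t) ^ d < ⟦ shatters k S I ⟧ * weight t k I * c
  I-heavy = proj₂ (∑-<⇒∃ (subsets n) sums)
  -- Strictness at `I` excludes both failures: an unshattered `I` makes the right-hand side 0, and a
  -- small one contradicts `weight-light`.
  good : shatters k S I ≡ true × d ≤ ∣ I ∣
  good with shatters k S I | I-heavy
  ... | false | ()
  ... | true  | h = refl , ≮⇒≥ λ i<d → <⇒≱ h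
    (≤-trans (≤-reflexive (cong (_* c) (*-identityˡ (weight t k I)))) (weight-light t k d I k≤4t (<⇒≤ i<d)))

truncate : ∀ {n} → ℕ → Subset n → Subset n
truncate d       []          = []
truncate d       (false ∷ I) = false ∷ truncate d I
truncate zero    (true ∷ I)  = false ∷ truncate zero I
truncate (suc d) (true ∷ I)  = true ∷ truncate d I

∣truncate∣ : ∀ {n} d (I : Subset n) → d ≤ ∣ I ∣ → ∣ truncate d I ∣ ≡ d
∣truncate∣ zero    []          h       = refl
∣truncate∣ d       (false ∷ I) h       = ∣truncate∣ d I h
∣truncate∣ zero    (true ∷ I)  h       = ∣truncate∣ zero I z≤n
∣truncate∣ (suc d) (true ∷ I)  (s≤s h) = cong suc (∣truncate∣ d I h)

-- Dropping a coordinate lowers the demand there from `k` branches to one, a weakening because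
-- `k ≥ 1`. It trims a shattered set of size at least `d` to size exactly `d`.
shatters-truncate : ∀ {t n} k .{{_ : NonZero k}} d (S : PointSet t n) I →
                    shatters k S I ≡ true → shatters k S (truncate d I) ≡ true
shatters-truncate k d S [] sh = sh
shatters-truncate {t} k d S (b ∷ I) sh = step d b (≤ᵇ-true⁻¹ sh)
  where
  mono : ∀ d → count (λ a → shatters k (slice S a) I) ≤ count (λ a → shatters k (slice S a) (truncate d I))
  mono d = ∑-mono (allFin t) λ a → ⟦⟧-mono _ (shatters-truncate k d (slice S a) I)
  step : ∀ d b → width k b ≤ count (λ a → shatters k (slice S a) I) → shatters k S (truncate d (b ∷ I)) ≡ true
  step d       false h = ≤ᵇ-true (≤-trans h (mono d))
  step zero    true  h = ≤ᵇ-true (≤-trans (>-nonZero⁻¹ k) (≤-trans h (mono zero)))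
  step (suc d) true  h = ≤ᵇ-true (≤-trans h (mono d))

-- Exponential inequalities

^-distribʳ-* : ∀ o m n → (m * n) ^ o ≡ m ^ o * n ^ o
^-distribʳ-* zero    m n = refl
^-distribʳ-* (suc o) m n = trans (cong (m * n *_) (^-distribʳ-* o m n)) ([m*n]*[o*p]≡[m*o]*[n*p] m n (m ^ o) (n ^ o))

^-swap : ∀ m n o → (m ^ n) ^ o ≡ (m ^ o) ^ n
^-swap m n o = trans (^-*-assoc m n o) (trans (cong (m ^_) (*-comm n o)) (sym (^-*-assoc m o n)))

^-cancelʳ-≤ : ∀ o .{{_ : NonZero o}} {m n} → m ^ o ≤ n ^ o → m ≤ n
^-cancelʳ-≤ o h = ≮⇒≥ λ n<m → <⇒≱ (^-monoˡ-< o n<m) h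

2^-cancel-≤ : ∀ {m n} → 2 ^ m ≤ 2 ^ n → m ≤ n
2^-cancel-≤ {m} {n} h = subst₂ _≤_ (⌊log₂[2^n]⌋≡n m) (⌊log₂[2^n]⌋≡n n) (⌊log₂⌋-mono-≤ h)

bernoulli-+ : ∀ a b m → a ^ m * (a + m * b) ≤ (a + b) ^ m * a
bernoulli-+ a b zero    = ≤-reflexive (cong (_+ 0) (+-identityʳ a))
bernoulli-+ a b (suc m) = begin
  a * a ^ m * (a + suc m * b)                       ≤⟨ m≤m+n _ (a ^ m * (m * b * b)) ⟩
  a * a ^ m * (a + suc m * b) + a ^ m * (m * b * b) ≡⟨ expand a b m (a ^ m) ⟩
  (a + b) * (a ^ m * (a + m * b))  ≤⟨ *-monoʳ-≤ (a + b) (bernoulli-+ a b m) ⟩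
  (a + b) * ((a + b) ^ m * a)      ≡⟨ *-assoc (a + b) ((a + b) ^ m) a ⟨
  (a + b) ^ suc m * a              ∎
  where
  open ≤-Reasoning
  expand : ∀ a b m p → a * p * (a + (1 + m) * b) + p * (m * b * b) ≡ (a + b) * (p * (a + m * b))
  expand = solve-∀

-- (1 − b / a) ^ m ≥ 1 − m b / a with a = c + b, free of subtraction.
bernoulli-∸ : ∀ c b m → (c + b) ^ m * (c + b) ≤ c ^ m * (c + b) + m * b * (c + b) ^ m
bernoulli-∸ c b zero    = ≤-reflexive (sym (+-identityʳ _))
bernoulli-∸ c b (suc m) = begin
  (c + b) * (c + b) ^ m * (c + b)
    ≡⟨ *-assoc (c + b) ((c + b) ^ m) (c + b) ⟩
  (c + b) * ((c + b) ^ m * (c + b))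
    ≤⟨ *-monoʳ-≤ (c + b) (bernoulli-∸ c b m) ⟩
  (c + b) * (c ^ m * (c + b) + m * b * (c + b) ^ m)
    ≡⟨ expand c b m (c ^ m) ((c + b) ^ m) ⟩
  c * c ^ m * (c + b) + (c ^ m * (b * (c + b)) + m * b * ((c + b) * (c + b) ^ m))
    ≤⟨ +-monoʳ-≤ (c * c ^ m * (c + b)) (+-monoˡ-≤ _ (*-monoˡ-≤ (b * (c + b)) (^-monoˡ-≤ m (m≤m+n c b)))) ⟩
  c * c ^ m * (c + b) + ((c + b) ^ m * (b * (c + b)) + m * b * ((c + b) * (c + b) ^ m))
    ≡⟨ collect c b m (c ^ m) ((c + b) ^ m) ⟩
  c ^ suc m * (c + b) + suc m * b * (c + b) ^ suc m
    ∎
  where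
  open ≤-Reasoning
  expand : ∀ c b m p q → (c + b) * (p * (c + b) + m * b * q) ≡ c * p * (c + b) + (p * (b * (c + b)) + m * b * ((c + b) * q))
  expand = solve-∀
  collect : ∀ c b m p q → c * p * (c + b) + (q * (b * (c + b)) + m * b * ((c + b) * q)) ≡ c * p * (c + b) + (1 + m) * b * ((c + b) * q)
  collect = solve-∀

module _ (N : ℕ) .{{_ : NonZero N}} where

  -- With D = N y: 1 + 1 / N ≤ (1 + 1 / D) ^ y.
  grow : ∀ y .{{_ : NonZero y}} → (N + 1) * (N * y) ^ y ≤ N * (N * y + 1) ^ y
  grow y = *-cancelʳ-≤ _ _ y (begin
    (N + 1) * D ^ y * y  ≡⟨ regroup N y (D ^ y) ⟩
    D ^ y * (D + y * 1)  ≤⟨ bernoulli-+ D 1 y ⟩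
    (D + 1) ^ y * D      ≡⟨ regroup′ N y ((D + 1) ^ y) ⟩
    N * (D + 1) ^ y * y  ∎)
    where
    open ≤-Reasoning
    D = N * y
    regroup : ∀ N y p → (N + 1) * p * y ≡ p * (N * y + y * 1)
    regroup = solve-∀
    regroup′ : ∀ N y p → p * (N * y) ≡ N * p * y
    regroup′ = solve-∀

  -- With D = N (w + u): 1 - u / (w + u) ≤ (1 - 1 / D) ^ (N u).
  shrink : ∀ w u c → c + 1 ≡ N * (w + u) → w * (c + 1) ^ (N * u) ≤ (w + u) * c ^ (N * u)
  shrink w u c D≡ = *-cancelˡ-≤ N (+-cancelʳ-≤ (N * u * 1 * D ^ a) _ _ (begin
    N * (w * D ^ a) + a * 1 * D ^ a        ≡⟨ regroup N w u (D ^ a) ⟩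
    D ^ a * (N * (w + u))                  ≡⟨ cong (D ^ a *_) D≡ ⟨
    D ^ a * D                              ≤⟨ bernoulli-∸ c 1 a ⟩
    c ^ a * D + a * 1 * D ^ a              ≡⟨ cong (λ D′ → c ^ a * D′ + a * 1 * D ^ a) D≡ ⟩
    c ^ a * (N * (w + u)) + a * 1 * D ^ a  ≡⟨ cong (_+ a * 1 * D ^ a) (regroup′ (c ^ a) N (w + u)) ⟩
    N * ((w + u) * c ^ a) + a * 1 * D ^ a  ∎))
    where
    open ≤-Reasoning
    D = c + 1
    a = N * u
    regroup : ∀ N w u p → N * (w * p) + N * u * 1 * p ≡ p * (N * (w + u))
    regroup = solve-∀
    regroup′ : ∀ p N y → p * (N * y) ≡ N * (y * p)
    regroup′ = solve-∀

  -- (1 − u / y) ^ y (1 + 1 / N) ^ (N u) ≤ (1 − 1 / (N y) ²) ^ (N u y) ≤ 1, where y = w + u.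
  exp-bound : ∀ w u .{{_ : NonZero (w + u)}} → w ^ (w + u) * (N + 1) ^ (N * u) ≤ (w + u) ^ (w + u) * N ^ (N * u)
  exp-bound w u = *-cancelʳ-≤ _ _ (D ^ (y * a) * D ^ (a * y)) {{m*n≢0 _ _ {{m^n≢0 D (y * a)}} {{m^n≢0 D (a * y)}}}} (begin
    w ^ y * (N + 1) ^ a * (D ^ (y * a) * D ^ (a * y))
      ≡⟨ regroup (w ^ y) ((N + 1) ^ a) (D ^ (y * a)) (D ^ (a * y)) ⟩
    ((N + 1) ^ a * D ^ (y * a)) * (w ^ y * D ^ (a * y))
      ≤⟨ *-mono-≤ grow^ shrink^ ⟩
    (N ^ a * (D + 1) ^ (y * a)) * (y ^ y * c ^ (a * y))
      ≡⟨ cong (λ e → (N ^ a * (D + 1) ^ e) * (y ^ y * c ^ (a * y))) (*-comm y a) ⟩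
    (N ^ a * (D + 1) ^ (a * y)) * (y ^ y * c ^ (a * y))
      ≡⟨ regroup′ (N ^ a) ((D + 1) ^ (a * y)) (y ^ y) (c ^ (a * y)) ⟩
    y ^ y * N ^ a * ((D + 1) ^ (a * y) * c ^ (a * y))
      ≡⟨ cong (y ^ y * N ^ a *_) (^-distribʳ-* (a * y) (D + 1) c) ⟨
    y ^ y * N ^ a * ((D + 1) * c) ^ (a * y)
      ≤⟨ *-monoʳ-≤ (y ^ y * N ^ a) (^-monoˡ-≤ (a * y) square) ⟩
    y ^ y * N ^ a * (D * D) ^ (a * y)
      ≡⟨ cong (y ^ y * N ^ a *_) (^-distribʳ-* (a * y) D D) ⟩
    y ^ y * N ^ a * (D ^ (a * y) * D ^ (a * y))
      ≡⟨ cong (λ e → y ^ y * N ^ a * (D ^ e * D ^ (a * y))) (*-comm a y) ⟩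
    y ^ y * N ^ a * (D ^ (y * a) * D ^ (a * y))
      ∎)
    where
    open ≤-Reasoning
    y = w + u
    a = N * u
    D = N * y
    instance
      D≢0 : NonZero D
      D≢0 = m*n≢0 N y
    c = pred D
    c+1≡D : c + 1 ≡ D
    c+1≡D = trans (+-comm c 1) (suc-pred D)
    square : (D + 1) * c ≤ D * D
    square = begin
      (D + 1) * c          ≡⟨ cong (λ D′ → (D′ + 1) * c) c+1≡D ⟨
      (c + 1 + 1) * c      ≤⟨ m≤m+n _ 1 ⟩
      (c + 1 + 1) * c + 1  ≡⟨ identity c ⟩
      (c + 1) * (c + 1)    ≡⟨ cong₂ _*_ c+1≡D c+1≡D ⟩
      D * D                ∎
      where
      identity : ∀ c → (c + 1 + 1) * c + 1 ≡ (c + 1) * (c + 1)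
      identity = solve-∀
    grow^ : (N + 1) ^ a * D ^ (y * a) ≤ N ^ a * (D + 1) ^ (y * a)
    grow^ = begin
      (N + 1) ^ a * D ^ (y * a)  ≡⟨ cong ((N + 1) ^ a *_) (^-*-assoc D y a) ⟨
      (N + 1) ^ a * (D ^ y) ^ a  ≡⟨ ^-distribʳ-* a (N + 1) (D ^ y) ⟨
      ((N + 1) * D ^ y) ^ a      ≤⟨ ^-monoˡ-≤ a (grow y) ⟩
      (N * (D + 1) ^ y) ^ a      ≡⟨ ^-distribʳ-* a N ((D + 1) ^ y) ⟩
      N ^ a * ((D + 1) ^ y) ^ a  ≡⟨ cong (N ^ a *_) (^-*-assoc (D + 1) y a) ⟩
      N ^ a * (D + 1) ^ (y * a)  ∎
    shrink^ : w ^ y * D ^ (a * y) ≤ y ^ y * c ^ (a * y)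
    shrink^ = begin
      w ^ y * D ^ (a * y)    ≡⟨ cong (w ^ y *_) (^-*-assoc D a y) ⟨
      w ^ y * (D ^ a) ^ y    ≡⟨ ^-distribʳ-* y w (D ^ a) ⟨
      (w * D ^ a) ^ y        ≡⟨ cong (λ D′ → (w * D′ ^ a) ^ y) c+1≡D ⟨
      (w * (c + 1) ^ a) ^ y  ≤⟨ ^-monoˡ-≤ y (shrink w u c c+1≡D) ⟩
      (y * c ^ a) ^ y        ≡⟨ ^-distribʳ-* y y (c ^ a) ⟩
      y ^ y * (c ^ a) ^ y    ≡⟨ cong (y ^ y *_) (^-*-assoc c a y) ⟩
      y ^ y * c ^ (a * y)    ∎
    regroup : ∀ p q r s → p * q * (r * s) ≡ q * r * (p * s)
    regroup = solve-∀
    regroup′ : ∀ p q r s → p * q * (r * s) ≡ r * p * (q * s)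
    regroup′ = solve-∀

-- e ³ > 20, tested at the approximation (1 + 1 / 400) ^ 400 of e.
20≤e³ : 20 * 400 ^ 1200 ≤ 401 ^ 1200
20≤e³ = ≤ᵇ⇒≤ (20 * 400 ^ 1200) (401 ^ 1200) tt

-- With y = w + 3 k this is (1 - 3 k / y) ^ y ≤ 20 ^ -k: `exp-bound` supplies (1 + 1 / N) ^ (-3 N
-- k), and the hypothesis says (1 + 1 / N) ^ (3 N) ≥ 20.
chernoff-base : ∀ N .{{_ : NonZero N}} → 20 * N ^ (N * 3) ≤ (N + 1) ^ (N * 3) →
                ∀ w k .{{_ : NonZero (w + 3 * k)}} → w ^ (w + 3 * k) * 20 ^ k ≤ (w + 3 * k) ^ (w + 3 * k)
chernoff-base N h w k = *-cancelʳ-≤ _ _ (N ^ (N * (3 * k))) {{m^n≢0 N (N * (3 * k))}} (begin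
  w ^ y * 20 ^ k * N ^ (N * (3 * k))    ≡⟨ cong (λ e → w ^ y * 20 ^ k * N ^ e) (*-assoc N 3 k) ⟨
  w ^ y * 20 ^ k * N ^ (N * 3 * k)      ≡⟨ cong (w ^ y * 20 ^ k *_) (^-*-assoc N (N * 3) k) ⟨
  w ^ y * 20 ^ k * (N ^ (N * 3)) ^ k    ≡⟨ *-assoc (w ^ y) (20 ^ k) _ ⟩
  w ^ y * (20 ^ k * (N ^ (N * 3)) ^ k)  ≡⟨ cong (w ^ y *_) (^-distribʳ-* k 20 (N ^ (N * 3))) ⟨
  w ^ y * (20 * N ^ (N * 3)) ^ k        ≤⟨ *-monoʳ-≤ (w ^ y) (^-monoˡ-≤ k h) ⟩
  w ^ y * ((N + 1) ^ (N * 3)) ^ k       ≡⟨ cong (w ^ y *_) (^-*-assoc (N + 1) (N * 3) k) ⟩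
  w ^ y * (N + 1) ^ (N * 3 * k)         ≡⟨ cong (λ e → w ^ y * (N + 1) ^ e) (*-assoc N 3 k) ⟩
  w ^ y * (N + 1) ^ (N * (3 * k))       ≤⟨ exp-bound N w (3 * k) ⟩
  y ^ y * N ^ (N * (3 * k))             ∎)
  where
  open ≤-Reasoning
  y = w + 3 * k

-- The exponent `d` need not be a multiple of y = w + 3 k, but d k = y M is. Hence both sides are
-- raised to the power `k`, where the M-th power of `chernoff-base` applies.
chernoff : ∀ w k d M .{{_ : NonZero k}} .{{_ : NonZero (w + 3 * k)}} → (w + 3 * k) * M ≡ d * k →
           20 ^ M * w ^ d ≤ (w + 3 * k) ^ d
chernoff w k d M yM≡dk = ^-cancelʳ-≤ k (begin
  (20 ^ M * w ^ d) ^ k        ≡⟨ ^-distribʳ-* k (20 ^ M) (w ^ d) ⟩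
  (20 ^ M) ^ k * (w ^ d) ^ k  ≡⟨ cong₂ _*_ (^-swap 20 M k) (power w) ⟩
  (20 ^ k) ^ M * (w ^ y) ^ M  ≡⟨ *-comm ((20 ^ k) ^ M) ((w ^ y) ^ M) ⟩
  (w ^ y) ^ M * (20 ^ k) ^ M  ≡⟨ ^-distribʳ-* M (w ^ y) (20 ^ k) ⟨
  (w ^ y * 20 ^ k) ^ M        ≤⟨ ^-monoˡ-≤ M (chernoff-base 400 20≤e³ w k) ⟩
  (y ^ y) ^ M                 ≡⟨ power y ⟨
  (y ^ d) ^ k                 ∎)
  where
  open ≤-Reasoning
  y = w + 3 * k
  power : ∀ z → (z ^ d) ^ k ≡ (z ^ y) ^ M
  power z = trans (^-*-assoc z d k) (trans (cong (z ^_) (sym yM≡dk)) (sym (^-*-assoc z y M)))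

-- c / P ≥ 16 ^ (− e / P) where P = c + e; the exponent q ≈ P / 2e makes Bernoulli's lower bound at least ½.
half-power : ∀ c e → e ≤ c → (c + e) ^ (c + e) ≤ c ^ (c + e) * 2 ^ (4 * e)
half-power c zero        e≤c = ≤-reflexive (trans (cong (λ P → P ^ (c + 0)) (+-identityʳ c)) (sym (*-identityʳ _)))
half-power c e@(suc _)   e≤c = *-cancelʳ-≤ _ _ (P ^ r) {{m^n≢0 P r}} (begin
  P ^ P * P ^ r                    ≡⟨ ^-distribˡ-+-* P P r ⟨
  P ^ (P + r)                      ≡⟨ cong (P ^_) P+r≡ ⟩
  P ^ (q * (4 * e))                ≡⟨ ^-*-assoc P q (4 * e) ⟨
  (P ^ q) ^ (4 * e)                ≤⟨ ^-monoˡ-≤ (4 * e) half ⟩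
  (2 * c ^ q) ^ (4 * e)            ≡⟨ ^-distribʳ-* (4 * e) 2 (c ^ q) ⟩
  2 ^ (4 * e) * (c ^ q) ^ (4 * e)  ≡⟨ cong (2 ^ (4 * e) *_) (^-*-assoc c q (4 * e)) ⟩
  2 ^ (4 * e) * c ^ (q * (4 * e))  ≡⟨ cong (λ z → 2 ^ (4 * e) * c ^ z) P+r≡ ⟨
  2 ^ (4 * e) * c ^ (P + r)        ≡⟨ cong (2 ^ (4 * e) *_) (^-distribˡ-+-* c P r) ⟩
  2 ^ (4 * e) * (c ^ P * c ^ r)    ≤⟨ *-monoʳ-≤ (2 ^ (4 * e)) (*-monoʳ-≤ (c ^ P) (^-monoˡ-≤ r (m≤m+n c e))) ⟩
  2 ^ (4 * e) * (c ^ P * P ^ r)    ≡⟨ regroup (2 ^ (4 * e)) (c ^ P) (P ^ r) ⟩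
  c ^ P * 2 ^ (4 * e) * P ^ r      ∎)
  where
  open ≤-Reasoning
  P = c + e
  instance
    P≢0 : NonZero P
    P≢0 = >-nonZero (<-≤-trans (s≤s z≤n) (m≤n+m e c))
  q = P / (2 * e)
  -- `P` need not be a multiple of `4 * e`. The exponent is padded from `P` to `q * (4 * e)`, which
  -- is large enough because e ≤ c gives q ≥ 1; the padding costs nothing since c ≤ P.
  r = q * (4 * e) ∸ P
  regroup : ∀ x y z → x * (y * z) ≡ y * x * z
  regroup = solve-∀
  2e≤P : 2 * e ≤ P
  2e≤P = ≤-trans (≤-reflexive (cong (_+_ e) (+-identityʳ e))) (+-monoˡ-≤ e e≤c)
  q≥1 : 1 ≤ q
  q≥1 = ≮⇒≥ λ q<1 → <⇒≱ (begin-strict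
    P                          ≡⟨ m≡m%n+[m/n]*n P (2 * e) ⟩
    P % (2 * e) + q * (2 * e)  ≡⟨ cong (λ q → P % (2 * e) + q * (2 * e)) (n<1⇒n≡0 q<1) ⟩
    P % (2 * e) + 0            ≡⟨ +-identityʳ _ ⟩
    P % (2 * e)                <⟨ m%n<n P (2 * e) ⟩
    2 * e                      ∎) 2e≤P
  P≤4qe : P ≤ q * (4 * e)
  P≤4qe = begin
    P                          ≡⟨ m≡m%n+[m/n]*n P (2 * e) ⟩
    P % (2 * e) + q * (2 * e)  ≤⟨ +-monoˡ-≤ (q * (2 * e)) (<⇒≤ (m%n<n P (2 * e))) ⟩
    2 * e + q * (2 * e)        ≡⟨ cong (_+ q * (2 * e)) (*-identityˡ (2 * e)) ⟨
    1 * (2 * e) + q * (2 * e)  ≤⟨ +-monoˡ-≤ (q * (2 * e)) (*-monoˡ-≤ (2 * e) q≥1) ⟩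
    q * (2 * e) + q * (2 * e)  ≡⟨ double q e ⟩
    q * (4 * e)                ∎
    where
    double : ∀ q e → q * (2 * e) + q * (2 * e) ≡ q * (4 * e)
    double = solve-∀
  P+r≡ : P + r ≡ q * (4 * e)
  P+r≡ = m+[n∸m]≡n P≤4qe
  half : P ^ q ≤ 2 * c ^ q
  half = *-cancelʳ-≤ _ _ P (+-cancelʳ-≤ (P ^ q * P) _ _ (begin
    P ^ q * P + P ^ q * P                        ≤⟨ +-mono-≤ (bernoulli-∸ c e q) (bernoulli-∸ c e q) ⟩
    (c ^ q * P + q * e * P ^ q) + (c ^ q * P + q * e * P ^ q)
                                                 ≡⟨ regroup′ (c ^ q) P q e (P ^ q) ⟩
    2 * c ^ q * P + P ^ q * (q * (2 * e))  ≤⟨ +-monoʳ-≤ (2 * c ^ q * P) (*-monoʳ-≤ (P ^ q) (m/n*n≤m P (2 * e))) ⟩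
    2 * c ^ q * P + P ^ q * P              ∎))
    where
    regroup′ : ∀ x P q e y → (x * P + q * e * y) + (x * P + q * e * y) ≡ 2 * x * P + y * (q * (2 * e))
    regroup′ = solve-∀

-- Lower bounds for the logarithm

j≤⌊log₂k^j⌋ : ∀ k j → 2 ≤ k → j ≤ ⌊log₂ (k ^ j) ⌋
j≤⌊log₂k^j⌋ k j 2≤k = subst (_≤ ⌊log₂ (k ^ j) ⌋) (⌊log₂[2^n]⌋≡n j) (⌊log₂⌋-mono-≤ (^-monoˡ-≤ j 2≤k))

-- log N ≥ g log k − 4 f / P, scaled by j P and with floors taken.
log-bound : ∀ k g M f N j .{{_ : NonZero k}} .{{_ : NonZero N}} →
            2 * f ≤ k ^ (M + g) → k ^ (M + g) ≤ f + k ^ M * N →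
            ⌊log₂ (k ^ j) ⌋ * g * k ^ (M + g) ≤ (⌊log₂ (N ^ j) ⌋ + 1) * k ^ (M + g) + 4 * f * j
log-bound k g M f N j 2f≤P P≤f+kN = 2^-cancel-≤ (begin
  2 ^ (a * g * P)                      ≡⟨ cong (2 ^_) (*-assoc a g P) ⟩
  2 ^ (a * (g * P))                    ≡⟨ ^-*-assoc 2 a (g * P) ⟨
  (2 ^ a) ^ (g * P)                    ≤⟨ ^-monoˡ-≤ (g * P) (2^⌊log₂n⌋≤n (k ^ j) {{m^n≢0 k j}}) ⟩
  (k ^ j) ^ (g * P)                    ≤⟨ *-cancelˡ-≤ ((k ^ j) ^ (M * P)) {{m^n≢0 (k ^ j) (M * P) {{m^n≢0 k j}}}} powers ⟩
  (N ^ j) ^ P * 2 ^ (4 * f * j)        ≤⟨ *-monoˡ-≤ (2 ^ (4 * f * j)) (^-monoˡ-≤ P (<⇒≤ (n<2^[1+⌊log₂n⌋] (N ^ j)))) ⟩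
  (2 ^ (1 + l)) ^ P * 2 ^ (4 * f * j)  ≡⟨ cong (_* 2 ^ (4 * f * j)) (^-*-assoc 2 (1 + l) P) ⟩
  2 ^ ((1 + l) * P) * 2 ^ (4 * f * j)  ≡⟨ ^-distribˡ-+-* 2 ((1 + l) * P) (4 * f * j) ⟨
  2 ^ ((1 + l) * P + 4 * f * j)        ≡⟨ cong (λ z → 2 ^ (z * P + 4 * f * j)) (+-comm 1 l) ⟩
  2 ^ ((l + 1) * P + 4 * f * j)        ∎)
  where
  open ≤-Reasoning
  P = k ^ (M + g)
  a = ⌊log₂ (k ^ j) ⌋
  l = ⌊log₂ (N ^ j) ⌋
  c = P ∸ f
  f≤P : f ≤ P
  f≤P = ≤-trans (m≤m+n f (f + 0)) 2f≤P
  c+f≡P : c + f ≡ P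
  c+f≡P = m∸n+n≡m f≤P
  f≤c : f ≤ c
  f≤c = +-cancelʳ-≤ f f c (begin
    f + f  ≡⟨ cong (_+_ f) (+-identityʳ f) ⟨
    2 * f  ≤⟨ 2f≤P ⟩
    P      ≡⟨ c+f≡P ⟨
    c + f  ∎)
  c≤kN : c ≤ k ^ M * N
  c≤kN = m≤n+o⇒m∸n≤o P f P≤f+kN
  P^P : P ^ P ≤ (k ^ M * N) ^ P * 2 ^ (4 * f)
  P^P = begin
    P ^ P                          ≡⟨ cong (λ z → z ^ z) c+f≡P ⟨
    (c + f) ^ (c + f)              ≤⟨ half-power c f f≤c ⟩
    c ^ (c + f) * 2 ^ (4 * f)      ≡⟨ cong (λ z → c ^ z * 2 ^ (4 * f)) c+f≡P ⟩
    c ^ P * 2 ^ (4 * f)            ≤⟨ *-monoˡ-≤ (2 ^ (4 * f)) (^-monoˡ-≤ P c≤kN) ⟩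
    (k ^ M * N) ^ P * 2 ^ (4 * f)  ∎
  powers : (k ^ j) ^ (M * P) * (k ^ j) ^ (g * P) ≤ (k ^ j) ^ (M * P) * ((N ^ j) ^ P * 2 ^ (4 * f * j))
  powers = begin
    (k ^ j) ^ (M * P) * (k ^ j) ^ (g * P)
      ≡⟨ ^-distribˡ-+-* (k ^ j) (M * P) (g * P) ⟨
    (k ^ j) ^ (M * P + g * P)
      ≡⟨ cong ((k ^ j) ^_) (*-distribʳ-+ P M g) ⟨
    (k ^ j) ^ ((M + g) * P)
      ≡⟨ ^-swap k j ((M + g) * P) ⟩
    (k ^ ((M + g) * P)) ^ j
      ≡⟨ cong (_^ j) (^-*-assoc k (M + g) P) ⟨
    (P ^ P) ^ j
      ≤⟨ ^-monoˡ-≤ j P^P ⟩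
    ((k ^ M * N) ^ P * 2 ^ (4 * f)) ^ j
      ≡⟨ ^-distribʳ-* j ((k ^ M * N) ^ P) (2 ^ (4 * f)) ⟩
    ((k ^ M * N) ^ P) ^ j * (2 ^ (4 * f)) ^ j
      ≡⟨ cong₂ _*_ (cong (_^ j) (^-distribʳ-* P (k ^ M) N)) (^-*-assoc 2 (4 * f) j) ⟩
    ((k ^ M) ^ P * N ^ P) ^ j * 2 ^ (4 * f * j)
      ≡⟨ cong (_* 2 ^ (4 * f * j)) (^-distribʳ-* j ((k ^ M) ^ P) (N ^ P)) ⟩
    ((k ^ M) ^ P) ^ j * (N ^ P) ^ j * 2 ^ (4 * f * j)
      ≡⟨ cong₂ (λ u v → u * v * 2 ^ (4 * f * j)) (trans (cong (_^ j) (^-*-assoc k M P)) (^-swap k (M * P) j)) (^-swap N P j) ⟩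
    (k ^ j) ^ (M * P) * (N ^ j) ^ P * 2 ^ (4 * f * j)
      ≡⟨ *-assoc ((k ^ j) ^ (M * P)) ((N ^ j) ^ P) (2 ^ (4 * f * j)) ⟩
    (k ^ j) ^ (M * P) * ((N ^ j) ^ P * 2 ^ (4 * f * j))
      ∎

module _ (k g M f j : ℕ) (2≤k : 2 ≤ k) .{{_ : NonZero (M + g)}} where

  private
    d = M + g
    P = k ^ d
    a = ⌊log₂ (k ^ j) ⌋

  -- The value log 0 = -1 is moved to the left-hand side.
  log-deficit-zero : P ≤ f → a * g * P + j * P ≤ P + 5 * (d * f * a)
  log-deficit-zero P≤f = begin
    a * g * P + j * P                              ≤⟨ +-mono-≤ (*-mono-≤ (*-monoʳ-≤ a (m≤n+m g M)) P≤f) (*-mono-≤ j≤ P≤f) ⟩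
    a * d * f + a * d * f                          ≤⟨ m≤n+m _ (P + 3 * (d * f * a)) ⟩
    P + 3 * (d * f * a) + (a * d * f + a * d * f)  ≡⟨ collect P d f a ⟩
    P + 5 * (d * f * a)                            ∎
    where
    open ≤-Reasoning
    -- This is where k ≥ 2 enters: the loss from log 0 = -1 is charged to d log k, which is at least
    -- 1. For k = 1 there would be nothing to charge it to.
    j≤ : j ≤ a * d
    j≤ = ≤-trans (j≤⌊log₂k^j⌋ k j 2≤k) (m≤m*n a d)
    collect : ∀ P d f a → P + 3 * (d * f * a) + (a * d * f + a * d * f) ≡ P + 5 * (d * f * a)
    collect = solve-∀

  -- The failure probability is at most f / P. Up to one half, `log-bound` loses only 4 f / P, paid
  -- for by log k ≥ 1. Beyond one half, log N ≥ 0 suffices, as g ≤ d ≤ 2 d f / P.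
  log-deficit : ∀ N .{{_ : NonZero N}} → P ≤ f + k ^ M * N →
                a * g * P ≤ (⌊log₂ (N ^ j) ⌋ + 1) * P + 5 * (d * f * a)
  log-deficit N P≤ with 2 * f ≤? P
  ... | yes 2f≤P = ≤-trans (log-bound k g M f N j {{>-nonZero (<-≤-trans (s≤s z≤n) 2≤k)}} 2f≤P P≤) (+-monoʳ-≤ _ (begin
    4 * f * j        ≤⟨ *-mono-≤ (*-monoˡ-≤ f (n≤1+n 4)) (j≤⌊log₂k^j⌋ k j 2≤k) ⟩
    5 * f * a        ≤⟨ m≤n*m (5 * f * a) d ⟩
    d * (5 * f * a)  ≡⟨ regroup d f a ⟩
    5 * (d * f * a)  ∎))
    where
    open ≤-Reasoning
    regroup : ∀ d f a → d * (5 * f * a) ≡ 5 * (d * f * a)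
    regroup = solve-∀
  ... | no  2f≰P = begin
    a * g * P                                    ≤⟨ *-mono-≤ (*-monoʳ-≤ a (m≤n+m g M)) (<⇒≤ (≰⇒> 2f≰P)) ⟩
    a * d * (2 * f)                              ≤⟨ m≤n+m _ (l+1 * P + 3 * (d * f * a)) ⟩
    l+1 * P + 3 * (d * f * a) + a * d * (2 * f)  ≡⟨ collect (l+1 * P) d f a ⟩
    l+1 * P + 5 * (d * f * a)                    ∎
    where
    open ≤-Reasoning
    l+1 = ⌊log₂ (N ^ j) ⌋ + 1
    collect : ∀ x d f a → x + 3 * (d * f * a) + a * d * (2 * f) ≡ x + 5 * (d * f * a)
    collect = solve-∀

-- After taking d-th roots and cancelling k ^ 5 t this says 5 ^ 5 · 4 < 2 ^ 4 · 4 ^ 5.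
volume-bound : ∀ k t d .{{_ : NonZero k}} .{{_ : NonZero t}} .{{_ : NonZero d}} →
               (5 * k) ^ (d * 5) * (4 * t) ^ d < (2 * k) ^ (4 * d) * t ^ d * 4 ^ (d * 5) * k ^ d
volume-bound k t d = begin-strict
  (5 * k) ^ (d * 5) * (4 * t) ^ d
    ≡⟨ cong (_* (4 * t) ^ d) (power (5 * k)) ⟩
  ((5 * k) ^ 5) ^ d * (4 * t) ^ d
    ≡⟨ ^-distribʳ-* d ((5 * k) ^ 5) (4 * t) ⟨
  ((5 * k) ^ 5 * (4 * t)) ^ d
    <⟨ ^-monoˡ-< d base ⟩
  ((2 * k) ^ 4 * t * 4 ^ 5 * k) ^ d
    ≡⟨ ^-distribʳ-* d ((2 * k) ^ 4 * t * 4 ^ 5) k ⟩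
  ((2 * k) ^ 4 * t * 4 ^ 5) ^ d * k ^ d
    ≡⟨ cong (_* k ^ d) (^-distribʳ-* d ((2 * k) ^ 4 * t) (4 ^ 5)) ⟩
  ((2 * k) ^ 4 * t) ^ d * (4 ^ 5) ^ d * k ^ d
    ≡⟨ cong₂ (λ u v → u * v * k ^ d) (^-distribʳ-* d ((2 * k) ^ 4) t) (sym (power 4)) ⟩
  ((2 * k) ^ 4) ^ d * t ^ d * 4 ^ (d * 5) * k ^ d
    ≡⟨ cong (λ z → z * t ^ d * 4 ^ (d * 5) * k ^ d) (^-*-assoc (2 * k) 4 d) ⟩
  (2 * k) ^ (4 * d) * t ^ d * 4 ^ (d * 5) * k ^ d
    ∎
  where
  open ≤-Reasoning
  power : ∀ x → x ^ (d * 5) ≡ (x ^ 5) ^ d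
  power x = trans (sym (^-*-assoc x d 5)) (^-swap x d 5)
  base : (5 * k) ^ 5 * (4 * t) < (2 * k) ^ 4 * t * 4 ^ 5 * k
  base = begin-strict
    (5 * k) ^ 5 * (4 * t)          ≡⟨ cong (_* (4 * t)) (^-distribʳ-* 5 5 k) ⟩
    5 ^ 5 * k ^ 5 * (4 * t)        ≡⟨ regroup (5 ^ 5) (k ^ 5) 4 t ⟩
    5 ^ 5 * 4 * (k ^ 5 * t)        <⟨ *-monoˡ-< (k ^ 5 * t) {{m*n≢0 _ t {{m^n≢0 k 5}}}} (<ᵇ⇒< (5 ^ 5 * 4) (2 ^ 4 * 4 ^ 5) tt) ⟩
    2 ^ 4 * 4 ^ 5 * (k ^ 5 * t)    ≡⟨ regroup′ (2 ^ 4) (4 ^ 5) k (k ^ 4) t ⟩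
    2 ^ 4 * k ^ 4 * t * 4 ^ 5 * k  ≡⟨ cong (λ z → z * t * 4 ^ 5 * k) (^-distribʳ-* 4 2 k) ⟨
    (2 * k) ^ 4 * t * 4 ^ 5 * k    ∎
    where
    regroup : ∀ a b c d → a * b * (c * d) ≡ a * c * (b * d)
    regroup = solve-∀
    regroup′ : ∀ a b k p t → a * b * (k * p * t) ≡ a * p * t * b * k
    regroup′ = solve-∀

-- The combinatorial core over ℕ. `f x / k ^ d` is the probability that the walk fails on `x`; both
-- (i) and (ii) follow from the last two inequalities alone, so the walk itself can stay hidden.
isoperimetry : ∀ t k d M .{{_ : NonZero k}} .{{_ : NonZero t}} .{{_ : NonZero d}} (S : PointSet t (d * 5)) →
               2 * k ≤ t → d * k ≡ 4 * t * M → card S ≡ (2 * k) ^ (4 * d) * t ^ d →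
               ∃[ T ] ∃[ I ] ∃[ f ]
                 ( T ⊆ S
                 × card T ≡ k ^ d
                 × ∣ I ∣ ≡ d
                 × (∀ x → k ^ d ≤ f x + k ^ M * card (N[ T , I , M ] x))
                 × 5 ^ M * ∑ (points t (d * 5)) f ≤ k ^ d * t ^ (d * 5) )
isoperimetry t k d M S 2k≤t dk≡4tM card-S =
  tree k S I , I , deficit k S I M , tree⊆ k S I , trans (card-tree k S I sh) (cong (k ^_) ∣I∣≡d) , ∣I∣≡d ,
  (λ x → subst (λ h → k ^ h ≤ deficit k S I M x + k ^ M * hits k S I M x) ∣I∣≡d (deficit-bound k S I M x sh)) ,
  *-cancelʳ-≤ _ _ (y ^ d) {{m^n≢0 y d}} total
  where
  open ≤-Reasoning
  k≤t : k ≤ t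
  k≤t = ≤-trans (m≤m+n k (k + 0)) 2k≤t
  large : (5 * k) ^ (d * 5) * (4 * t) ^ d < card S * 4 ^ (d * 5) * k ^ d
  large = <-≤-trans (volume-bound k t d) (≤-reflexive (cong (λ c → c * 4 ^ (d * 5) * k ^ d) (sym card-S)))
  shattered = large⇒shatters k d S (≤-trans k≤t (m≤n*m t 4)) large
  I = truncate d (proj₁ shattered)
  ∣I∣≡d : ∣ I ∣ ≡ d
  ∣I∣≡d = ∣truncate∣ d (proj₁ shattered) (proj₂ (proj₂ shattered))
  sh : shatters k S I ≡ true
  sh = shatters-truncate k d S (proj₁ shattered) (proj₁ (proj₂ shattered))
  s = t ∸ k
  -- With y = 4 t, the quotient w / y is 1 - 3 k / 4 t, the base of the tail bound.
  w = k + 4 * s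
  y = w + 3 * k
  k+s≡t : k + s ≡ t
  k+s≡t = m+[n∸m]≡n k≤t
  y≡4t : y ≡ 4 * t
  y≡4t = trans (identity k s) (cong (4 *_) k+s≡t)
    where
    identity : ∀ k s → k + 4 * s + 3 * k ≡ 4 * (k + s)
    identity = solve-∀
  instance
    y≢0 : NonZero y
    y≢0 = >-nonZero (<-≤-trans (>-nonZero⁻¹ k) (≤-trans (m≤m+n k (4 * s)) (m≤m+n w (3 * k))))
  ∑f = ∑ (points t (d * 5)) (deficit k S I M)
  raw : y ^ d * ∑f ≤ 4 ^ M * (w ^ d * k ^ d * t ^ (d * 5))
  raw = subst₂ (λ y h → y ^ h * ∑f ≤ 4 ^ M * (w ^ h * k ^ h * t ^ (d * 5))) (sym y≡4t) ∣I∣≡d (go t k+s≡t S {I} sh)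
    where
    -- `∑-deficit` speaks of the alphabet of size `k + s`, so `t` is generalised here to be replaced
    -- by that sum.
    go : ∀ t → k + s ≡ t → ∀ {n} (S : PointSet t n) {I} → shatters k S I ≡ true →
         (4 * t) ^ ∣ I ∣ * ∑ (points t n) (deficit k S I M) ≤ 4 ^ M * (w ^ ∣ I ∣ * k ^ ∣ I ∣ * t ^ n)
    go t refl S {I} sh = ∑-deficit k s S I M sh
  total : 5 ^ M * ∑f * y ^ d ≤ k ^ d * t ^ (d * 5) * y ^ d
  total = begin
    5 ^ M * ∑f * y ^ d                               ≡⟨ regroup (5 ^ M) ∑f (y ^ d) ⟩
    5 ^ M * (y ^ d * ∑f)                             ≤⟨ *-monoʳ-≤ (5 ^ M) raw ⟩
    5 ^ M * (4 ^ M * (w ^ d * k ^ d * t ^ (d * 5)))  ≡⟨ regroup′ (5 ^ M) (4 ^ M) (w ^ d) (k ^ d) (t ^ (d * 5)) ⟩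
    k ^ d * t ^ (d * 5) * (5 ^ M * 4 ^ M * w ^ d)    ≡⟨ cong (λ z → k ^ d * t ^ (d * 5) * (z * w ^ d)) (^-distribʳ-* M 5 4) ⟨
    k ^ d * t ^ (d * 5) * (20 ^ M * w ^ d)           ≤⟨ *-monoʳ-≤ (k ^ d * t ^ (d * 5)) (chernoff w k d M
                                                              (trans (cong (_* M) y≡4t) (sym dk≡4tM))) ⟩
    k ^ d * t ^ (d * 5) * y ^ d                          ∎
    where
    regroup : ∀ a b c → a * b * c ≡ a * (c * b)
    regroup = solve-∀
    regroup′ : ∀ a b c d e → a * (b * (c * d * e)) ≡ d * e * (a * b * c)
    regroup′ = solve-∀

-- Rational and real estimates

ℚ-ring : AlmostCommutativeRing 0ℓ 0ℓ
ℚ-ring = fromCommutativeRing ℚ.+-*-commutativeRing (λ p → dec⇒maybe (0ℚ ℚ.≟ p))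

toℚᵘ-/ : ∀ a b → toℚᵘ (+ a /ℚ suc b) ℚᵘ.≃ ℚᵘ.mkℚᵘ (+ a) b
toℚᵘ-/ a b = ℚ.toℚᵘ-fromℚᵘ (ℚᵘ.mkℚᵘ (+ a) b)

fromℕ-+ : ∀ a b → fromℕ (a + b) ≡ fromℕ a +ℚ fromℕ b
fromℕ-+ a b = sym (/-+ a b 0)

fromℕ-* : ∀ a b → fromℕ (a * b) ≡ fromℕ a *ℚ fromℕ b
fromℕ-* a b = ℚ.toℚᵘ-injective (begin
  toℚᵘ (fromℕ (a * b))                  ≈⟨ toℚᵘ-/ (a * b) 0 ⟩
  ℚᵘ.mkℚᵘ (+ (a * b)) 0                 ≈⟨ ℚᵘ.*≡* (cong (ℤ._* + 1) (ℤ.pos-* a b)) ⟩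
  ℚᵘ.mkℚᵘ (+ a) 0 ℚᵘ.* ℚᵘ.mkℚᵘ (+ b) 0  ≈⟨ ℚᵘ.*-cong (toℚᵘ-/ a 0) (toℚᵘ-/ b 0) ⟨
  toℚᵘ (fromℕ a) ℚᵘ.* toℚᵘ (fromℕ b)    ≈⟨ ℚ.toℚᵘ-homo-* (fromℕ a) (fromℕ b) ⟨
  toℚᵘ (fromℕ a *ℚ fromℕ b)             ∎)
  where open import Relation.Binary.Reasoning.Setoid ℚᵘ.≃-setoid

fromℕ-^ : ∀ a m → fromℕ (a ^ m) ≡ fromℕ a ^ℚ m
fromℕ-^ a zero    = refl
fromℕ-^ a (suc m) = trans (fromℕ-* a (a ^ m)) (cong (fromℕ a *ℚ_) (fromℕ-^ a m))

/-*-cancel : ∀ a b .{{_ : NonZero b}} → (+ a /ℚ b) *ℚ fromℕ b ≡ fromℕ a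
/-*-cancel a (suc b) = ℚ.toℚᵘ-injective (begin
  toℚᵘ ((+ a /ℚ suc b) *ℚ fromℕ (suc b))         ≈⟨ ℚ.toℚᵘ-homo-* (+ a /ℚ suc b) (fromℕ (suc b)) ⟩
  toℚᵘ (+ a /ℚ suc b) ℚᵘ.* toℚᵘ (fromℕ (suc b))  ≈⟨ ℚᵘ.*-cong (toℚᵘ-/ a b) (toℚᵘ-/ (suc b) 0) ⟩
  ℚᵘ.mkℚᵘ (+ a) b ℚᵘ.* ℚᵘ.mkℚᵘ (+ suc b) 0       ≈⟨ ℚᵘ.*≡* (ℤ.*-assoc (+ a) (+ suc b) (+ 1)) ⟩
  ℚᵘ.mkℚᵘ (+ a) 0                                ≈⟨ toℚᵘ-/ a 0 ⟨
  toℚᵘ (fromℕ a)                                 ∎)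
  where open import Relation.Binary.Reasoning.Setoid ℚᵘ.≃-setoid

/-mono-≤ : ∀ a b c d .{{_ : NonZero b}} .{{_ : NonZero d}} → a * d ≤ c * b → + a /ℚ b ≤ℚ + c /ℚ d
/-mono-≤ a (suc b) c (suc d) = /-≤ {a} {b} {c} {d}

fromℕ-mono-≤ : ∀ {a b} → a ≤ b → fromℕ a ≤ℚ fromℕ b
fromℕ-mono-≤ {a} {b} a≤b = /-mono-≤ a 1 b 1 (*-monoˡ-≤ 1 a≤b)

fromℕ-injective : ∀ {a b} → fromℕ a ≡ fromℕ b → a ≡ b
fromℕ-injective {a} {b} eq = ℤ.+-injective (begin
  + a          ≡⟨ ℤ.*-identityʳ (+ a) ⟨
  + a ℤ.* + 1  ≡⟨ ℚᵘ.drop-*≡* (ℚᵘ.≃-trans (ℚᵘ.≃-sym (toℚᵘ-/ a 0)) (ℚᵘ.≃-trans (ℚᵘ.≃-reflexive (cong toℚᵘ eq)) (toℚᵘ-/ b 0))) ⟩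
  + b ℤ.* + 1  ≡⟨ ℤ.*-identityʳ (+ b) ⟩
  + b          ∎)
  where open ≡-Reasoning

fromℕ-nonNeg : ∀ a → NonNegative (fromℕ a)
fromℕ-nonNeg a = nonNegative (fromℕ-mono-≤ {0} {a} z≤n)

fromℕ-pos : ∀ a .{{_ : NonZero a}} → Positive (fromℕ a)
fromℕ-pos (suc a) = ℚ.normalize-pos (suc a) 1

archimedes : ∀ ε → 0ℚ <ℚ ε → + 1 /ℚ suc (ℚᵘ.ℚᵘ.denominator-1 (toℚᵘ ε)) ≤ℚ ε
archimedes ε@(mkℚ (+ suc p) d _) _ = subst (+ 1 /ℚ suc d ≤ℚ_) (ℚ.↥p/↧p≡p ε)
  (/-mono-≤ 1 (suc d) (suc p) (suc d) (*-monoˡ-≤ (suc d) {1} {suc p} (s≤s z≤n)))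
archimedes (mkℚ (+ 0) d _) (*<* (ℤ.+<+ ()))
archimedes (mkℚ ℤ.-[1+ p ] d _) (*<* ())

-- Here r = 2 k / t, so the power equation reads (2 k / t) ^ (4 n) = (s / t ^ n) ^ 5; it is
-- multiplied by t ^ (5 n).
IsPower⇒ : ∀ {r} k t s n .{{_ : NonZero t}} .{{_ : NonZero (t ^ n)}} →
           IsPower r (+ s /ℚ t ^ n) 5 (4 * n) → fromℕ k ≡ (+ t /ℚ 2) *ℚ r →
           (2 * k) ^ (4 * n) * t ^ n ≡ s ^ 5
IsPower⇒ {r} k t s n (_ , r^4n≡μ^5) k≡ = fromℕ-injective (begin
  fromℕ ((2 * k) ^ (4 * n) * t ^ n)
    ≡⟨ trans (fromℕ-* ((2 * k) ^ (4 * n)) (t ^ n)) (cong (_*ℚ T) (trans (fromℕ-^ (2 * k) (4 * n)) (cong (_^ℚ (4 * n)) 2k≡))) ⟩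
  (fromℕ t *ℚ r) ^ℚ (4 * n) *ℚ T
    ≡⟨ cong (_*ℚ T) (^-distrib-* (fromℕ t) r (4 * n)) ⟩
  fromℕ t ^ℚ (4 * n) *ℚ r ^ℚ (4 * n) *ℚ T
    ≡⟨ cong₂ (λ u v → u *ℚ v *ℚ T) (sym (fromℕ-^ t (4 * n))) r^4n≡μ^5 ⟩
  fromℕ (t ^ (4 * n)) *ℚ μ′ ^ℚ 5 *ℚ T
    ≡⟨ regroup (fromℕ (t ^ (4 * n))) (μ′ ^ℚ 5) T ⟩
  μ′ ^ℚ 5 *ℚ (T *ℚ fromℕ (t ^ (4 * n)))
    ≡⟨ cong (μ′ ^ℚ 5 *ℚ_) T^5 ⟩
  μ′ ^ℚ 5 *ℚ T ^ℚ 5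
    ≡⟨ ^-distrib-* μ′ T 5 ⟨
  (μ′ *ℚ T) ^ℚ 5
    ≡⟨ cong (_^ℚ 5) (/-*-cancel s (t ^ n)) ⟩
  fromℕ s ^ℚ 5
    ≡⟨ fromℕ-^ s 5 ⟨
  fromℕ (s ^ 5)
    ∎)
  where
  open ≡-Reasoning
  open Exp (CommutativeRing.commutativeSemiring ℚ.+-*-commutativeRing) using (^-distrib-*)
  μ′ = + s /ℚ t ^ n
  T = fromℕ (t ^ n)
  regroup : ∀ a b c → a *ℚ b *ℚ c ≡ b *ℚ (c *ℚ a)
  regroup = Ring.solve-∀ ℚ-ring
  regroup′ : ∀ a b c → a *ℚ (b *ℚ c) ≡ (b *ℚ a) *ℚ c
  regroup′ = Ring.solve-∀ ℚ-ring
  2k≡ : fromℕ (2 * k) ≡ fromℕ t *ℚ r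
  2k≡ = begin
    fromℕ (2 * k)                 ≡⟨ fromℕ-* 2 k ⟩
    fromℕ 2 *ℚ fromℕ k            ≡⟨ cong (fromℕ 2 *ℚ_) k≡ ⟩
    fromℕ 2 *ℚ ((+ t /ℚ 2) *ℚ r)  ≡⟨ regroup′ (fromℕ 2) (+ t /ℚ 2) r ⟩
    (+ t /ℚ 2) *ℚ fromℕ 2 *ℚ r    ≡⟨ cong (_*ℚ r) (/-*-cancel t 2) ⟩
    fromℕ t *ℚ r                  ∎
  T^5 : T *ℚ fromℕ (t ^ (4 * n)) ≡ T ^ℚ 5
  T^5 = begin
    T *ℚ fromℕ (t ^ (4 * n))  ≡⟨ cong (λ e → T *ℚ fromℕ (t ^ e)) (*-comm 4 n) ⟩
    T *ℚ fromℕ (t ^ (n * 4))  ≡⟨ cong (λ z → T *ℚ fromℕ z) (^-*-assoc t n 4) ⟨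
    T *ℚ fromℕ ((t ^ n) ^ 4)  ≡⟨ cong (T *ℚ_) (fromℕ-^ (t ^ n) 4) ⟩
    T ^ℚ 5                    ∎

-- Sums the pointwise logarithm bound over all `x`: `c` clears its denominators, `β` is the loss
-- from the floor, and `γ` is the price of failure.
∑-approx-bound : ∀ {A : Set} (xs : List A) (F : A → ℝ) (f : A → ℕ) i (α β γ c : ℚ) →
                 (∀ x → α ≤ℚ approx (F x) i *ℚ c +ℚ β +ℚ γ *ℚ fromℕ (f x)) →
                 fromℕ (length xs) *ℚ α ≤ℚ approx (sumℝ (map F xs)) i *ℚ c +ℚ fromℕ (length xs) *ℚ β +ℚ γ *ℚ fromℕ (∑ xs f)
∑-approx-bound []       F f i α β γ c h = ℚ.≤-reflexive (zeros α β γ c)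
  where
  zeros : ∀ α β γ c → 0ℚ *ℚ α ≡ 0ℚ *ℚ c +ℚ 0ℚ *ℚ β +ℚ γ *ℚ 0ℚ
  zeros = Ring.solve-∀ ℚ-ring
∑-approx-bound (x ∷ xs) F f i α β γ c h = begin
  fromℕ (suc (length xs)) *ℚ α
    ≡⟨ cong (_*ℚ α) (fromℕ-+ 1 (length xs)) ⟩
  (1ℚ +ℚ n) *ℚ α
    ≡⟨ expand n α ⟩
  α +ℚ n *ℚ α
    ≤⟨ ℚ.+-mono-≤ (h x) (∑-approx-bound xs F f i α β γ c h) ⟩
  (X *ℚ c +ℚ β +ℚ γ *ℚ fromℕ (f x)) +ℚ (Y *ℚ c +ℚ n *ℚ β +ℚ γ *ℚ fromℕ (∑ xs f))
    ≡⟨ collect X Y c n β γ (fromℕ (f x)) (fromℕ (∑ xs f)) ⟩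
  (X +ℚ Y) *ℚ c +ℚ (1ℚ +ℚ n) *ℚ β +ℚ γ *ℚ (fromℕ (f x) +ℚ fromℕ (∑ xs f))
    ≡⟨ cong₂ (λ u v → (X +ℚ Y) *ℚ c +ℚ u *ℚ β +ℚ γ *ℚ v) (fromℕ-+ 1 (length xs)) (fromℕ-+ (f x) (∑ xs f)) ⟨
  (X +ℚ Y) *ℚ c +ℚ fromℕ (suc (length xs)) *ℚ β +ℚ γ *ℚ fromℕ (f x + ∑ xs f)
    ∎
  where
  open ℚ.≤-Reasoning
  n X Y : ℚ
  n = fromℕ (length xs)
  X = approx (F x) i
  Y = approx (sumℝ (map F xs)) i
  expand : ∀ n α → (1ℚ +ℚ n) *ℚ α ≡ α +ℚ n *ℚ α
  expand = Ring.solve-∀ ℚ-ring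
  collect : ∀ X Y c n β γ f s → (X *ℚ c +ℚ β +ℚ γ *ℚ f) +ℚ (Y *ℚ c +ℚ n *ℚ β +ℚ γ *ℚ s) ≡ (X +ℚ Y) *ℚ c +ℚ (1ℚ +ℚ n) *ℚ β +ℚ γ *ℚ (f +ℚ s)
  collect = Ring.solve-∀ ℚ-ring

length-points : ∀ t n → length (points t n) ≡ t ^ n
length-points t n = begin
  length (points t n)       ≡⟨ *-identityʳ _ ⟨
  length (points t n) * 1   ≡⟨ ∑-const (points t n) 1 ⟨
  ∑ (points t n) (λ _ → 1)  ≡⟨ ∑-points-const t n 1 ⟩
  t ^ n * 1                 ≡⟨ *-identityʳ _ ⟩
  t ^ n                     ∎
  where open ≡-Reasoning

card≤ : ∀ {t n} (A : PointSet t n) → card A ≤ t ^ n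
card≤ {t} {n} A = begin
  card A                    ≡⟨ card≡∑ A ⟩
  ∑ (points t n) (⟦_⟧ ∘ A)  ≤⟨ ∑-mono (points t n) (λ x → ⟦⟧≤1 (A x)) ⟩
  ∑ (points t n) (λ _ → 1)  ≡⟨ ∑-points-const t n 1 ⟩
  t ^ n * 1                 ≡⟨ *-identityʳ _ ⟩
  t ^ n                     ∎
  where
  open ≤-Reasoning

-- Emptiness of `A x` forces `f x` up to `P`, so by Markov's inequality the number of such `x` is at
-- most ∑ f / P.
card-isEmpty : ∀ {t n} (A : Point t n → PointSet t n) (f : Point t n → ℕ) P c Q .{{_ : NonZero P}} →
               (∀ x → P ≤ f x + c * card (A x)) → Q * ∑ (points t n) f ≤ P * t ^ n →
               card (λ x → isEmpty (A x)) * Q ≤ t ^ n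
card-isEmpty {t} {n} A f P c Q h ∑f≤ = *-cancelˡ-≤ P (begin
  P * (card empty * Q)                        ≡⟨ regroup P (card empty) Q ⟩
  Q * (P * card empty)                        ≡⟨ cong (λ z → Q * (P * z)) (card≡∑ empty) ⟩
  Q * (P * ∑ (points t n) (⟦_⟧ ∘ empty))      ≡⟨ cong (Q *_) (*-distribˡ-∑ P (points t n) (⟦_⟧ ∘ empty)) ⟩
  Q * ∑ (points t n) (λ x → P * ⟦ empty x ⟧)  ≤⟨ *-monoʳ-≤ Q (∑-mono (points t n) bound) ⟩
  Q * ∑ (points t n) f                        ≤⟨ ∑f≤ ⟩
  P * t ^ n                                   ∎)
  where
  open ≤-Reasoning
  empty : PointSet t n
  empty x = isEmpty (A x)
  regroup : ∀ P e Q → P * (e * Q) ≡ Q * (P * e)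
  regroup = solve-∀
  case-null : ∀ {B : Set} (xs : List B) p → P ≤ p + c * length xs → P * ⟦ null xs ⟧ ≤ p
  case-null []       p P≤ = begin
    P * 1      ≡⟨ *-identityʳ P ⟩
    P          ≤⟨ P≤ ⟩
    p + c * 0  ≡⟨ cong (_+_ p) (*-zeroʳ c) ⟩
    p + 0      ≡⟨ +-identityʳ p ⟩
    p          ∎
  case-null (_ ∷ _)  p P≤ = ≤-trans (≤-reflexive (*-zeroʳ P)) z≤n
  bound : ∀ x → P * ⟦ empty x ⟧ ≤ f x
  bound x = case-null (elements (A x)) (f x) (h x)

approx-log₂ : ∀ k .{{_ : NonZero k}} i → approx (log₂ k) i ≡ log₂-approx k i
approx-log₂ (suc k) i = refl

module _ (k g M i : ℕ) (2≤k : 2 ≤ k) .{{_ : NonZero (M + g)}} where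

  private
    d = M + g
    P = k ^ d
    j = suc i
    a = ⌊log₂ (k ^ j) ⌋

  -- The summand `fromℕ P` pays for the floor in the approximation of log N, which loses up to 1 /
  -- j. At N = 0 it is spare: there P ≤ f, and the value -1 is absorbed by the last summand.
  approx-log₂-bound : ∀ N f → P ≤ f + k ^ M * N →
                      fromℕ (a * g * P) ≤ℚ approx (log₂ N) i *ℚ fromℕ (j * P) +ℚ fromℕ P +ℚ fromℕ (5 * (d * a)) *ℚ fromℕ f
  approx-log₂-bound zero    f P≤ = begin
    fromℕ (a * g * P)
      ≡⟨ shift (fromℕ (a * g * P)) (fromℕ (j * P)) ⟩
    fromℕ (a * g * P) +ℚ fromℕ (j * P) +ℚ -ℚ 1ℚ *ℚ fromℕ (j * P)
      ≡⟨ cong (_+ℚ -ℚ 1ℚ *ℚ fromℕ (j * P)) (fromℕ-+ (a * g * P) (j * P)) ⟨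
    fromℕ (a * g * P + j * P) +ℚ -ℚ 1ℚ *ℚ fromℕ (j * P)
      ≤⟨ ℚ.+-monoˡ-≤ _ (fromℕ-mono-≤ (log-deficit-zero k g M f j 2≤k P≤f)) ⟩
    fromℕ (P + 5 * (d * f * a)) +ℚ -ℚ 1ℚ *ℚ fromℕ (j * P)
      ≡⟨ cong (_+ℚ -ℚ 1ℚ *ℚ fromℕ (j * P)) (trans (cong (λ z → fromℕ (P + z)) (regroup d f a))
           (trans (fromℕ-+ P _) (cong (fromℕ P +ℚ_) (fromℕ-* (5 * (d * a)) f)))) ⟩
    fromℕ P +ℚ fromℕ (5 * (d * a)) *ℚ fromℕ f +ℚ -ℚ 1ℚ *ℚ fromℕ (j * P)
      ≡⟨ rotate (fromℕ P) (fromℕ (5 * (d * a)) *ℚ fromℕ f) (-ℚ 1ℚ *ℚ fromℕ (j * P)) ⟩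
    -ℚ 1ℚ *ℚ fromℕ (j * P) +ℚ fromℕ P +ℚ fromℕ (5 * (d * a)) *ℚ fromℕ f
      ∎
    where
    open ℚ.≤-Reasoning
    P≤f : P ≤ f
    P≤f = ≤-trans P≤ (≤-reflexive (trans (cong (_+_ f) (*-zeroʳ (k ^ M))) (+-identityʳ f)))
    regroup : ∀ d f a → 5 * (d * f * a) ≡ 5 * (d * a) * f
    regroup = solve-∀
    shift : ∀ x y → x ≡ x +ℚ y +ℚ -ℚ 1ℚ *ℚ y
    shift = Ring.solve-∀ ℚ-ring
    rotate : ∀ x y z → x +ℚ y +ℚ z ≡ z +ℚ x +ℚ y
    rotate = Ring.solve-∀ ℚ-ring
  approx-log₂-bound N@(suc _) f P≤ = begin
    fromℕ (a * g * P)
      ≤⟨ fromℕ-mono-≤ (log-deficit k g M f j 2≤k N P≤) ⟩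
    fromℕ ((l + 1) * P + 5 * (d * f * a))
      ≡⟨ cong fromℕ (regroup l P d f a) ⟩
    fromℕ (l * P + P + 5 * (d * a) * f)
      ≡⟨ trans (fromℕ-+ (l * P + P) _) (cong₂ _+ℚ_ (fromℕ-+ (l * P) P) (fromℕ-* (5 * (d * a)) f)) ⟩
    fromℕ (l * P) +ℚ fromℕ P +ℚ fromℕ (5 * (d * a)) *ℚ fromℕ f
      ≡⟨ cong (λ z → z +ℚ fromℕ P +ℚ fromℕ (5 * (d * a)) *ℚ fromℕ f) l*P ⟩
    (+ l /ℚ j) *ℚ fromℕ (j * P) +ℚ fromℕ P +ℚ fromℕ (5 * (d * a)) *ℚ fromℕ f
      ∎
    where
    open ℚ.≤-Reasoning
    l = ⌊log₂ (N ^ j) ⌋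
    regroup : ∀ l P d f a → (l + 1) * P + 5 * (d * f * a) ≡ l * P + P + 5 * (d * a) * f
    regroup = solve-∀
    l*P : fromℕ (l * P) ≡ (+ l /ℚ j) *ℚ fromℕ (j * P)
    l*P = begin-equality
      fromℕ (l * P)                       ≡⟨ fromℕ-* l P ⟩
      fromℕ l *ℚ fromℕ P                  ≡⟨ cong (_*ℚ fromℕ P) (/-*-cancel l j) ⟨
      (+ l /ℚ j) *ℚ fromℕ j *ℚ fromℕ P    ≡⟨ ℚ.*-assoc (+ l /ℚ j) (fromℕ j) (fromℕ P) ⟩
      (+ l /ℚ j) *ℚ (fromℕ j *ℚ fromℕ P)  ≡⟨ cong ((+ l /ℚ j) *ℚ_) (fromℕ-* j P) ⟨
      (+ l /ℚ j) *ℚ fromℕ (j * P)         ∎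

  -- The pointwise price 5 (1 - p) d log k averages to at most 5 d log k / 5 ^ M, and 5 d is the n
  -- of (ii). All denominators are cleared at once by `Z`; only the floor's 1 / j remains as an
  -- error.
  approx-𝔼-bound : ∀ t n .{{_ : NonZero t}} (c f : Point t n → ℕ) →
                   (∀ x → P ≤ f x + k ^ M * c x) → 5 ^ M * ∑ (points t n) f ≤ P * t ^ n →
                   fromℕ g *ℚ log₂-approx k i
                     ≤ℚ approx (𝔼 {t} {n} (λ x → log₂ (c x))) i +ℚ (+ 1 /ℚ j) +ℚ (+ (d * 5) /ℚ 5 ^ M) {{m^n≢0 5 M}} *ℚ log₂-approx k i
  approx-𝔼-bound t n c f h ∑f≤ = ℚ.*-cancelʳ-≤-pos Z {{Z>0}} (begin
    fromℕ g *ℚ λ′ *ℚ Z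
      ≡⟨ collect₁ (fromℕ g) λ′ Q T J Pq ⟩
    Q *ℚ (T *ℚ (λ′ *ℚ J *ℚ fromℕ g *ℚ Pq))
      ≡⟨ cong (λ z → Q *ℚ (T *ℚ (z *ℚ fromℕ g *ℚ Pq))) (/-*-cancel a j) ⟩
    Q *ℚ (T *ℚ (fromℕ a *ℚ fromℕ g *ℚ Pq))
      ≡⟨ cong (λ z → Q *ℚ (T *ℚ z)) (trans (fromℕ-* (a * g) P) (cong (_*ℚ Pq) (fromℕ-* a g))) ⟨
    Q *ℚ (T *ℚ fromℕ (a * g * P))
      ≤⟨ ℚ.*-monoˡ-≤-nonNeg Q {{fromℕ-nonNeg (5 ^ M)}} summed ⟩
    Q *ℚ (X *ℚ fromℕ (j * P) +ℚ T *ℚ Pq +ℚ γ *ℚ Σ)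
      ≡⟨ expand Q (X *ℚ fromℕ (j * P)) (T *ℚ Pq) γ Σ ⟩
    Q *ℚ (X *ℚ fromℕ (j * P) +ℚ T *ℚ Pq) +ℚ γ *ℚ (Q *ℚ Σ)
      ≤⟨ ℚ.+-monoʳ-≤ (Q *ℚ (X *ℚ fromℕ (j * P) +ℚ T *ℚ Pq)) (ℚ.*-monoˡ-≤-nonNeg γ {{fromℕ-nonNeg (5 * (d * a))}} QΣ≤) ⟩
    Q *ℚ (X *ℚ fromℕ (j * P) +ℚ T *ℚ Pq) +ℚ γ *ℚ (Pq *ℚ T)
      ≡⟨ cong₂ (λ u v → Q *ℚ (X *ℚ u +ℚ T *ℚ Pq) +ℚ v *ℚ (Pq *ℚ T)) (fromℕ-* j P) γ≡ ⟩
    Q *ℚ (X *ℚ (J *ℚ Pq) +ℚ T *ℚ Pq) +ℚ ν *ℚ Q *ℚ (λ′ *ℚ J) *ℚ (Pq *ℚ T)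
      ≡⟨ cong₂ (λ u v → Q *ℚ (u *ℚ (J *ℚ Pq) +ℚ v) +ℚ ν *ℚ Q *ℚ (λ′ *ℚ J) *ℚ (Pq *ℚ T))
           (trans (cong (_*ℚ X) τT≡1) (ℚ.*-identityˡ X)) (trans (cong (_*ℚ (T *ℚ Pq)) (/-*-cancel 1 j)) (ℚ.*-identityˡ _)) ⟨
    Q *ℚ (τ *ℚ T *ℚ X *ℚ (J *ℚ Pq) +ℚ ι *ℚ J *ℚ (T *ℚ Pq)) +ℚ ν *ℚ Q *ℚ (λ′ *ℚ J) *ℚ (Pq *ℚ T)
      ≡⟨ collect₂ τ X ι ν λ′ Q T J Pq ⟩
    (τ *ℚ X +ℚ ι +ℚ ν *ℚ λ′) *ℚ Z
      ∎)
    where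
    open ℚ.≤-Reasoning
    λ′ Q T J Pq X ι ν τ γ Σ Z : ℚ
    λ′ = log₂-approx k i
    Q = fromℕ (5 ^ M)
    T = fromℕ (t ^ n)
    J = fromℕ j
    Pq = fromℕ P
    X = approx (sumℝ (map (λ x → log₂ (c x)) (points t n))) i
    ι = + 1 /ℚ j
    ν = (+ (d * 5) /ℚ 5 ^ M) {{m^n≢0 5 M}}
    τ = (+ 1 /ℚ t ^ n) {{m^n≢0 t n}}
    γ = fromℕ (5 * (d * a))
    Σ = fromℕ (∑ (points t n) f)
    Z = Q *ℚ T *ℚ J *ℚ Pq
    instance
      k≢0 : NonZero k
      k≢0 = >-nonZero (<-≤-trans (s≤s z≤n) 2≤k)
    Z>0 : Positive Z
    Z>0 = subst Positive (trans (fromℕ-* (5 ^ M * t ^ n * j) P) (cong (_*ℚ Pq)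
            (trans (fromℕ-* (5 ^ M * t ^ n) j) (cong (_*ℚ J) (fromℕ-* (5 ^ M) (t ^ n))))))
            (fromℕ-pos (5 ^ M * t ^ n * j * P)
              {{m*n≢0 _ P {{m*n≢0 (5 ^ M * t ^ n) j {{m*n≢0 (5 ^ M) (t ^ n) {{m^n≢0 5 M}} {{m^n≢0 t n}}}}}} {{m^n≢0 k d}}}})
    summed : T *ℚ fromℕ (a * g * P) ≤ℚ X *ℚ fromℕ (j * P) +ℚ T *ℚ Pq +ℚ γ *ℚ Σ
    summed = subst (λ z → fromℕ z *ℚ fromℕ (a * g * P) ≤ℚ X *ℚ fromℕ (j * P) +ℚ fromℕ z *ℚ Pq +ℚ γ *ℚ Σ) (length-points t n)
      (∑-approx-bound (points t n) (λ x → log₂ (c x)) f i _ Pq γ (fromℕ (j * P)) (λ x → approx-log₂-bound (c x) (f x) (h x)))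
    QΣ≤ : Q *ℚ Σ ≤ℚ Pq *ℚ T
    QΣ≤ = subst₂ _≤ℚ_ (fromℕ-* (5 ^ M) _) (fromℕ-* P (t ^ n)) (fromℕ-mono-≤ ∑f≤)
    γ≡ : γ ≡ ν *ℚ Q *ℚ (λ′ *ℚ J)
    γ≡ = begin-equality
      fromℕ (5 * (d * a))       ≡⟨ cong fromℕ (regroup d a) ⟩
      fromℕ (d * 5 * a)         ≡⟨ fromℕ-* (d * 5) a ⟩
      fromℕ (d * 5) *ℚ fromℕ a  ≡⟨ cong₂ _*ℚ_ (/-*-cancel (d * 5) (5 ^ M) {{m^n≢0 5 M}}) (/-*-cancel a j) ⟨
      ν *ℚ Q *ℚ (λ′ *ℚ J)       ∎
      where
      regroup : ∀ d a → 5 * (d * a) ≡ d * 5 * a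
      regroup = solve-∀
    τT≡1 : τ *ℚ T ≡ 1ℚ
    τT≡1 = /-*-cancel 1 (t ^ n) {{m^n≢0 t n}}
    collect₁ : ∀ g l Q T J P → g *ℚ l *ℚ (Q *ℚ T *ℚ J *ℚ P) ≡ Q *ℚ (T *ℚ (l *ℚ J *ℚ g *ℚ P))
    collect₁ = Ring.solve-∀ ℚ-ring
    expand : ∀ Q x y g s → Q *ℚ (x +ℚ y +ℚ g *ℚ s) ≡ Q *ℚ (x +ℚ y) +ℚ g *ℚ (Q *ℚ s)
    expand = Ring.solve-∀ ℚ-ring
    collect₂ : ∀ τ X ι ν l Q T J P →
               Q *ℚ (τ *ℚ T *ℚ X *ℚ (J *ℚ P) +ℚ ι *ℚ J *ℚ (T *ℚ P)) +ℚ ν *ℚ Q *ℚ (l *ℚ J) *ℚ (P *ℚ T)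
                 ≡ (τ *ℚ X +ℚ ι +ℚ ν *ℚ l) *ℚ (Q *ℚ T *ℚ J *ℚ P)
    collect₂ = Ring.solve-∀ ℚ-ring

𝔼-bound : ∀ k g M d t n → M + g ≡ d → 2 ≤ k → .{{_ : NonZero d}} .{{_ : NonZero t}} (c f : Point t n → ℕ) →
          (∀ x → k ^ d ≤ f x + k ^ M * c x) → 5 ^ M * ∑ (points t n) f ≤ k ^ d * t ^ n →
          (fromℕ d -ℚ fromℕ M) • log₂ k -ℝ (+ (d * 5) /ℚ 5 ^ M) {{m^n≢0 5 M}} • log₂ k
            ≤ℝ 𝔼 {t} {n} (λ x → log₂ (c x))
𝔼-bound k@(suc _) g M _ t n refl 2≤k c f h ∑f≤ ε 0<ε = N , λ i N≤i →
  let
    open ℚ.≤-Reasoning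
    l = log₂-approx k i
    ι = + 1 /ℚ suc i
    e = approx (𝔼 {t} {n} (λ x → log₂ (c x))) i
  in begin
  (fromℕ (M + g) -ℚ fromℕ M) *ℚ l +ℚ -ℚ 1ℚ *ℚ (ν *ℚ l)
    ≡⟨ cong (λ z → (z -ℚ fromℕ M) *ℚ l +ℚ -ℚ 1ℚ *ℚ (ν *ℚ l)) (fromℕ-+ M g) ⟩
  (fromℕ M +ℚ fromℕ g -ℚ fromℕ M) *ℚ l +ℚ -ℚ 1ℚ *ℚ (ν *ℚ l)
    ≡⟨ cancel (fromℕ M) (fromℕ g) l (ν *ℚ l) ⟩
  fromℕ g *ℚ l -ℚ ν *ℚ l
    ≤⟨ ℚ.+-monoˡ-≤ (-ℚ (ν *ℚ l)) (approx-𝔼-bound k g M i 2≤k t n c f h ∑f≤) ⟩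
  e +ℚ ι +ℚ ν *ℚ l -ℚ ν *ℚ l
    ≡⟨ cancel′ (e +ℚ ι) (ν *ℚ l) ⟩
  e +ℚ ι
    ≤⟨ ℚ.+-monoʳ-≤ e (ℚ.≤-trans (/-mono-≤ 1 (suc i) 1 (suc N) (*-monoʳ-≤ 1 (s≤s N≤i))) (archimedes ε 0<ε)) ⟩
  e +ℚ ε
    ∎
  where
  -- From this index on, the remaining error 1 / (i + 1) is at most 1 over the denominator of ε,
  -- hence at most ε.
  N = ℚᵘ.ℚᵘ.denominator-1 (toℚᵘ ε)
  ν = (+ ((M + g) * 5) /ℚ 5 ^ M) {{m^n≢0 5 M}}
  cancel : ∀ m g l v → (m +ℚ g -ℚ m) *ℚ l +ℚ -ℚ 1ℚ *ℚ v ≡ g *ℚ l -ℚ v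
  cancel = Ring.solve-∀ ℚ-ring
  cancel′ : ∀ x v → x +ℚ v -ℚ v ≡ x
  cancel′ = Ring.solve-∀ ℚ-ring

-- From the hypotheses on k and M to the theorem

0^d≡0 : ∀ d .{{_ : NonZero d}} → 0 ^ d ≡ 0
0^d≡0 (suc d) = refl

-- Since n = 5 d, both sides of the cleared equation are fifth powers, and the fractional exponent
-- disappears on taking roots.
IsPower⇒card : ∀ {t} d {r} k (S : PointSet t (d * 5)) .{{_ : NonZero t}} →
               IsPower r (μ S) 5 (4 * (d * 5)) → fromℕ k ≡ (+ t /ℚ 2) *ℚ r →
               card S ≡ (2 * k) ^ (4 * d) * t ^ d
IsPower⇒card {t} d k S power k≡ = ≤-antisym (^-cancelʳ-≤ 5 (≤-reflexive fifth)) (^-cancelʳ-≤ 5 (≤-reflexive (sym fifth)))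
  where
  open ≡-Reasoning
  instance
    t^n≢0 : NonZero (t ^ (d * 5))
    t^n≢0 = m^n≢0 t (d * 5)
  fifth : card S ^ 5 ≡ ((2 * k) ^ (4 * d) * t ^ d) ^ 5
  fifth = begin
    card S ^ 5                             ≡⟨ IsPower⇒ k t (card S) (d * 5) power k≡ ⟨
    (2 * k) ^ (4 * (d * 5)) * t ^ (d * 5)  ≡⟨ cong₂ (λ e z → (2 * k) ^ e * z) (*-assoc 4 d 5) (^-*-assoc t d 5) ⟨
    (2 * k) ^ (4 * d * 5) * (t ^ d) ^ 5    ≡⟨ cong (_* (t ^ d) ^ 5) (^-*-assoc (2 * k) (4 * d) 5) ⟨
    ((2 * k) ^ (4 * d)) ^ 5 * (t ^ d) ^ 5  ≡⟨ ^-distribʳ-* 5 ((2 * k) ^ (4 * d)) (t ^ d) ⟨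
    ((2 * k) ^ (4 * d) * t ^ d) ^ 5        ∎

-- This is μ(S) ≤ 1, after the common factor `t ^ d` is cancelled and the root of order `4 * d` is
-- taken.
card⇒2k≤t : ∀ {t} d k (S : PointSet t (d * 5)) .{{_ : NonZero t}} .{{_ : NonZero d}} →
            card S ≡ (2 * k) ^ (4 * d) * t ^ d → 2 * k ≤ t
card⇒2k≤t {t} d k S card-S = ^-cancelʳ-≤ (4 * d) {{m*n≢0 4 d}} (*-cancelʳ-≤ _ _ (t ^ d) {{m^n≢0 t d}} (begin
  (2 * k) ^ (4 * d) * t ^ d  ≡⟨ card-S ⟨
  card S                     ≤⟨ card≤ S ⟩
  t ^ (d * 5)                ≡⟨ cong (t ^_) (regroup d) ⟩
  t ^ (4 * d + d)            ≡⟨ ^-distribˡ-+-* t (4 * d) d ⟩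
  t ^ (4 * d) * t ^ d        ∎))
  where
  open ≤-Reasoning
  regroup : ∀ d → d * 5 ≡ 4 * d + d
  regroup = solve-∀

M-equation : ∀ {t} d k M .{{_ : NonZero t}} → fromℕ M ≡ (+ (d * 5 * k) /ℚ (20 * t)) {{m*n≢0 20 t}} → d * k ≡ 4 * t * M
M-equation {t} d k M M≡ = *-cancelʳ-≡ _ _ 5 (begin
  d * k * 5      ≡⟨ regroup d k ⟩
  d * 5 * k      ≡⟨ fromℕ-injective cleared ⟨
  M * (20 * t)   ≡⟨ regroup′ M t ⟩
  4 * t * M * 5  ∎)
  where
  open ≡-Reasoning
  regroup : ∀ d k → d * k * 5 ≡ d * 5 * k
  regroup = solve-∀
  regroup′ : ∀ M t → M * (20 * t) ≡ 4 * t * M * 5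
  regroup′ = solve-∀
  cleared : fromℕ (M * (20 * t)) ≡ fromℕ (d * 5 * k)
  cleared = trans (fromℕ-* M (20 * t)) (trans (cong (_*ℚ fromℕ (20 * t)) M≡) (/-*-cancel (d * 5 * k) (20 * t) {{m*n≢0 20 t}}))

M≤d : ∀ t d k M .{{_ : NonZero k}} → 2 * k ≤ t → d * k ≡ 4 * t * M → M ≤ d
M≤d t d k M 2k≤t dk≡4tM = *-cancelʳ-≤ M d k (begin
  M * k        ≤⟨ *-monoʳ-≤ M (≤-trans (m≤m+n k (k + 0)) 2k≤t) ⟩
  M * t        ≤⟨ m≤n*m (M * t) 4 ⟩
  4 * (M * t)  ≡⟨ regroup M t ⟩
  4 * t * M    ≡⟨ dk≡4tM ⟨
  d * k        ∎)
  where
  open ≤-Reasoning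
  regroup : ∀ M t → 4 * (M * t) ≡ 4 * t * M
  regroup = solve-∀

-- The size `d` is a parameter of its own, so that the proof can run with n = d * 5 and the quotient
-- `n / 5` is restored by a single rewriting.
Isoperimetric : ∀ t n d k M .{{_ : NonZero t}} → PointSet t n → Set
Isoperimetric t n d k M S = ∃[ T ] ∃[ I ]
  ( T ⊆ S
  × card T ≡ k ^ d
  × ∣ I ∣ ≡ d
  × μ (λ x → isEmpty (N[ T , I , M ] x)) ≤ℚ (+ 1 /ℚ 5 ^ M) {{m^n≢0 5 M}}
  × (2 ≤ k →
      (fromℕ d -ℚ fromℕ M) • log₂ k -ℝ (+ n /ℚ 5 ^ M) {{m^n≢0 5 M}} • log₂ k
        ≤ℝ 𝔼 {t} {n} (λ x → log₂ (card (N[ T , I , M ] x)))) )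

-- With k = 0 the equation for `M` gives M = 0, so the bound in (i) is 1. The empty `T` has the
-- right size, 0 ^ d = 0, because d ≥ 1.
isoperimetric-zero : ∀ t d .{{_ : NonZero t}} .{{_ : NonZero d}} (S : PointSet t (d * 5)) → Isoperimetric t (d * 5) d 0 0 S
isoperimetric-zero t d S =
  (λ _ → false) , truncate d ⊤ , (λ _ ()) ,
  trans (card≡∑ {t} {d * 5} (λ _ → false)) (trans (∑-zero (points t (d * 5))) (sym (0^d≡0 d))) ,
  ∣truncate∣ d (⊤ {d * 5}) (subst (d ≤_) (sym (∣⊤∣≡n (d * 5))) (m≤m*n d 5)) ,
  /-mono-≤ (card empty) (t ^ (d * 5)) 1 1 {{m^n≢0 t (d * 5)}}
    (subst₂ _≤_ (sym (*-identityʳ _)) (sym (*-identityˡ _)) (card≤ empty)) ,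
  λ ()
  where
  empty : PointSet t (d * 5)
  empty x = isEmpty (N[ (λ _ → false) , truncate d ⊤ , 0 ] x)

isoperimetric-positive : ∀ t d k M .{{_ : NonZero t}} .{{_ : NonZero d}} .{{_ : NonZero k}} (S : PointSet t (d * 5)) →
                         d * k ≡ 4 * t * M → card S ≡ (2 * k) ^ (4 * d) * t ^ d → Isoperimetric t (d * 5) d k M S
isoperimetric-positive t d k M S dk≡4tM card-S =
  let
    2k≤t = card⇒2k≤t d k S card-S
    T , I , f , T⊆S , card-T , ∣I∣≡d , large , ∑f≤ = isoperimetry t k d M S 2k≤t dk≡4tM card-S
  in
  T , I , T⊆S , card-T , ∣I∣≡d ,
  /-mono-≤ (card (λ x → isEmpty (N[ T , I , M ] x))) (t ^ (d * 5)) 1 (5 ^ M) {{m^n≢0 t (d * 5)}} {{m^n≢0 5 M}}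
    (≤-trans (card-isEmpty N[ T , I , M ] f (k ^ d) (k ^ M) (5 ^ M) {{m^n≢0 k d}} large ∑f≤)
               (≤-reflexive (sym (*-identityˡ _)))) ,
  -- M ≤ d makes the truncated difference a true one, so it agrees with the rational d - M of (ii).
  λ 2≤k → 𝔼-bound k (d ∸ M) M d t (d * 5) (m+[n∸m]≡n (M≤d t d k M 2k≤t dk≡4tM)) 2≤k
            (λ x → card (N[ T , I , M ] x)) f large ∑f≤

isoperimetric : ∀ {t} d {k M} .{{_ : NonZero t}} .{{_ : NonZero (d * 5)}} (S : PointSet t (d * 5)) →
                card S ≡ (2 * k) ^ (4 * d) * t ^ d → d * k ≡ 4 * t * M → Isoperimetric t (d * 5) d k M S
isoperimetric {t} d {k} {M} S card-S dk≡4tM = go k card-S dk≡4tM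
  where
  instance
    d≢0 : NonZero d
    d≢0 = m*n≢0⇒m≢0 d
  go : ∀ k → card S ≡ (2 * k) ^ (4 * d) * t ^ d → d * k ≡ 4 * t * M → Isoperimetric t (d * 5) d k M S
  go zero      _      dk≡4tM = subst (λ M → Isoperimetric t (d * 5) d 0 M S) (sym M≡0) (isoperimetric-zero t d S)
    where
    M≡0 : M ≡ 0
    M≡0 = m*n≡0⇒m≡0 M (4 * t) {{m*n≢0 4 t}} (trans (*-comm M (4 * t)) (trans (sym dk≡4tM) (*-zeroʳ d)))
  go k@(suc _) card-S dk≡4tM = isoperimetric-positive t d k M S dk≡4tM card-S

theorem3 : (n t : ℕ) .{{_ : NonZero n}} .{{_ : NonZero t}} →
    (S : PointSet t n) (k M : ℕ) (r : ℚ) →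
    5 ∣ n →
    IsPower r (μ S) 5 (4 * n) →
    fromℕ k ≡ (+ t /ℚ 2) *ℚ r →
    fromℕ M ≡ (+ (n * k) /ℚ (20 * t)) {{m*n≢0 20 t}} →
    ∃[ T ] ∃[ I ]
    ( T ⊆ S
    × card T ≡ k ^ (n / 5)
    × ∣ I ∣ ≡ n / 5
    × μ (λ x → isEmpty (N[ T , I , M ] x)) ≤ℚ (+ 1 /ℚ 5 ^ M) {{m^n≢0 5 M}}
    × (2 ≤ k →
    (fromℕ (n / 5) -ℚ fromℕ M) • log₂ k -ℝ (+ n /ℚ 5 ^ M) {{m^n≢0 5 M}} • log₂ k
    ≤ℝ 𝔼 {t} {n} (λ x → log₂ (card (N[ T , I , M ] x)))) )
theorem3 _ t S k M r (divides d refl) power k≡ M≡ =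
  subst (λ h → Isoperimetric t (d * 5) h k M S) (sym (m*n/n≡m d 5))
    (isoperimetric d S (IsPower⇒card d k S power k≡) (M-equation d k M M≡))
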